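{- There is a pair $\mathfrak{K}$ of (non-isomorphic) computable structures such that $\mathfrak{K}$ is learnable, but $\mathfrak{K}$ is not learnable by a computable learner.
   Context: Structures. All structures considered are in a relational signature, i.e. a signature with no function symbols (the members of a family share one signature), and have as domain the set $\omega$ of natural numbers. A structure is identified with its atomic diagram (the collection of atomic formulas true of it), regarded via a Gödel numbering as a subset of $\omega$; it is computable if this set is computable. Two structures are copies of each other if they are isomorphic. For a structure $\mathcal{S}$ and $n\in\omega$, $\mathcal{S}\restriction_n$ denotes the finite substructure obtained by restricting $\mathcal{S}$ to the domain $\{0,1,\ldots,n\}$. Learning. Let $\mathfrak{K}$ be a finite family of pairwise non-isomorphic computable structures. - The learning domain is the collection of all copies of the structures from $\mathfrak{K}$: $\mathrm{LD}(\mathfrak{K})=\bigcup_{\mathcal{A}\in\mathfrak{K}}\{\mathcal{S} : \mathcal{S}\cong\mathcal{A}\}$. - The hypothesis space is $\mathrm{HS}(\mathfrak{K})=\{\ulcorner\mathcal{A}\urcorner : \mathcal{A}\in\mathfrak{K}\}\cup\{?\}$, which contains one formal symbol $\ulcorner\mathcal{A}\urcorner$ for each $\mathcal{A}\in\mathfrak{K}$ (a conjecture about the isomorphism type of the observed structure) and a question mark symbol. - A learner sees, by stages, all positive and negative data about a given structure in the learning domain and outputs conjectures; formally, it is a function $M$ from $\{\mathcal{S}\restriction_n : \mathcal{S}\in\mathrm{LD}(\mathfrak{K}),\ n\in\omega\}$ to $\mathrm{HS}(\mathfrak{K})$. In general $M$ can be a function of any complexity. - $M$ learns $\mathfrak{K}$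 if for every $\mathcal{S}\in\mathrm{LD}(\mathfrak{K})$ and every $\mathcal{A}\in\mathfrak{K}$: $\lim_{n\to\infty}M(\mathcal{S}\restriction_n)=\ulcorner\mathcal{A}\urcorner$ (i.e. $M(\mathcal{S}\restriction_n)=\ulcorner\mathcal{A}\urcorner$ for all sufficiently large $n$) if and only if $\mathcal{S}$ is a copy of $\mathcal{A}$. - $\mathfrak{K}$ is learnable if some learner learns $\mathfrak{K}$; it is learnable by a computable learner if some learner that learns $\mathfrak{K}$ is a computable function. -}

module Defs where

open import Data.Bool using (Bool; T)
open import Data.Bool.Properties using (T?)
open import Data.Fin using (Fin; toℕ)
open import Data.List using (List; []; _∷_; _++_; map; concatMap; filter; upTo; allFin; cartesianProductWith)
open import Data.Maybe using (Maybe; just; nothing)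
open import Data.Nat using (ℕ; zero; suc; _+_; _≤_; _<_; _≡ᵇ_)
open import Data.Product using (Σ-syntax; ∃-syntax; ∃₂; _×_; _,_)
open import Data.Refinement using (Refinement; Refinement-syntax; value; _,_)
open import Data.Irrelevant using ([_])
open import Data.Sum using (_⊎_)
open import Data.Vec as Vec using (Vec; []; _∷_)
open import Data.Vec.Relation.Binary.Pointwise.Inductive using (Pointwise)
open import Function.Bundles using (_↔_; _⇔_; module Inverse)
open import Level using (0ℓ)
open import Relation.Binary.PropositionalEquality using (_≡_; _≢_; refl)
open import Relation.Nullary using (¬_)
open import Relation.Unary using (Pred)

-- Kleene's partial recursive functions, with a big-step semantics:
-- f [ xs ]⇓ y means that f is defined at xs with value y.

data Rec : ℕ → Set where
  zeroᴿ : ∀ {n} → Rec n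
  sucᴿ  : Rec 1
  proj  : ∀ {n} → Fin n → Rec n
  comp  : ∀ {m n} → Rec m → Vec (Rec n) m → Rec n
  prim  : ∀ {n} → Rec n → Rec (suc (suc n)) → Rec (suc n)
  μ     : ∀ {n} → Rec (suc n) → Rec n

infix 4 _[_]⇓_

data _[_]⇓_ : ∀ {n} → Rec n → Vec ℕ n → ℕ → Set where
  ⇓zero : ∀ {n} {xs : Vec ℕ n} → zeroᴿ [ xs ]⇓ 0
  ⇓suc  : ∀ {x} → sucᴿ [ x ∷ [] ]⇓ suc x
  ⇓proj : ∀ {n} {xs : Vec ℕ n} (i : Fin n) → proj i [ xs ]⇓ Vec.lookup xs i
  ⇓comp : ∀ {m n} {f : Rec m} {gs : Vec (Rec n) m} {xs ys z} →
          Pointwise (λ g y → g [ xs ]⇓ y) gs ys → f [ ys ]⇓ z →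
          comp f gs [ xs ]⇓ z
  ⇓prim-zero : ∀ {n} {f : Rec n} {g xs z} →
          f [ xs ]⇓ z → prim f g [ 0 ∷ xs ]⇓ z
  ⇓prim-suc  : ∀ {n} {f : Rec n} {g k xs y z} →
          prim f g [ k ∷ xs ]⇓ y → g [ k ∷ y ∷ xs ]⇓ z →
          prim f g [ suc k ∷ xs ]⇓ z
  ⇓μ    : ∀ {n} {f : Rec (suc n)} {xs k} →
          f [ k ∷ xs ]⇓ 0 →
          (∀ j → j < k → ∃[ y ] f [ j ∷ xs ]⇓ suc y) →
          μ f [ xs ]⇓ k

ComputableSet : Pred ℕ 0ℓ → Set
ComputableSet X =
  ∃[ χ ] ∀ x → (X x × χ [ x ∷ [] ]⇓ 1) ⊎ (¬ X x × χ [ x ∷ [] ]⇓ 0)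

-- The Cantor pairing function (x + y)(x + y + 1)/2 + y.

triangle : ℕ → ℕ
triangle zero    = 0
triangle (suc n) = suc n + triangle n

pair : ℕ → ℕ → ℕ
pair x y = triangle (x + y) + y

codeList : List ℕ → ℕ
codeList []       = 0
codeList (x ∷ xs) = suc (pair x (codeList xs))

-- Signatures are finite, so that the finite substructures shown to a
-- learner are finite objects, with codes a computable learner can read.

record Signature : Set where
  field
    size  : ℕ
    arity : Fin size → ℕ

open Signature

-- Structures with domain ω.  Under excluded middle, Bool-valued relations are
-- arbitrary relations; they are not assumed to be computable.

Structure : Signature → Set
Structure L = (i : Fin (size L)) → Vec ℕ (arity L i) → Bool

module _ {L : Signature} where

  infix 4 _≅_

  _≅_ : Structure L → Structure L → Set
  S ≅ R = Σ[ f ∈ ℕ ↔ ℕ ] ∀ i v → S i v ≡ R i (Vec.map (Inverse.to f) v)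

-- Atomic formulas with elements of ω as parameters.

data Atom (L : Signature) : Set where
  rel : (i : Fin (size L)) → Vec ℕ (arity L i) → Atom L
  _≐_ : ℕ → ℕ → Atom L

module _ {L : Signature} where

  codeAtom : Atom L → ℕ
  codeAtom (a ≐ b)   = pair 0 (pair a b)
  codeAtom (rel i v) = pair (suc (toℕ i)) (codeList (Vec.toList v))

  holds : Structure L → Atom L → Bool
  holds S (rel i v) = S i v
  holds S (a ≐ b)   = a ≡ᵇ b

  AtomicDiagram : Structure L → Pred ℕ 0ℓ
  AtomicDiagram S x = Σ[ φ ∈ Atom L ] (T (holds S φ) × codeAtom φ ≡ x)

  ComputableStructure : Structure L → Set
  ComputableStructure S = ComputableSet (AtomicDiagram S)

tuples : {A : Set} → List A → (k : ℕ) → List (Vec A k)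
tuples xs zero    = [] ∷ []
tuples xs (suc k) = cartesianProductWith _∷_ xs (tuples xs k)

atomsOver : (L : Signature) → List ℕ → List (Atom L)
atomsOver L xs =
  cartesianProductWith _≐_ xs xs ++
  concatMap (λ i → map (rel i) (tuples xs (arity L i))) (allFin (size L))

-- A finite structure is identified with its atomic diagram, listed in the
-- order of atomsOver.  The atoms a ≐ a record the domain, so the size of the
-- finite structure is not lost.

FiniteDiagram : Signature → Set
FiniteDiagram L = List (Atom L)

codeDiagram : {L : Signature} → FiniteDiagram L → ℕ
codeDiagram F = codeList (map codeAtom F)

-- The restriction to the domain {0, …, n}, which includes n.

infix 8 _↾_

_↾_ : {L : Signature} → Structure L → ℕ → FiniteDiagram L
_↾_ {L} S n = filter (λ φ → T? (holds S φ)) (atomsOver L (upTo (suc n)))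

record Family (L : Signature) (m : ℕ) : Set where
  field
    member         : Fin m → Structure L
    computable     : ∀ a → ComputableStructure (member a)
    non-isomorphic : ∀ a b → a ≢ b → ¬ (member a ≅ member b)

open Family

-- just a is the symbol for the isomorphism type of member a; nothing is "?".

Hypothesis : ℕ → Set
Hypothesis m = Maybe (Fin m)

codeHypothesis : ∀ {m} → Hypothesis m → ℕ
codeHypothesis nothing  = 0
codeHypothesis (just a) = suc (toℕ a)

module _ {L : Signature} {m : ℕ} (K : Family L m) where

  LD : Pred (Structure L) 0ℓ
  LD S = ∃[ a ] S ≅ member K a

  Observation : Set
  Observation = [ F ∈ FiniteDiagram L ∣ ∃₂ (λ S n → LD S × F ≡ S ↾ n) ]

  observe : (S : Structure L) → LD S → ℕ → Observation
  observe S S∈LD n = S ↾ n , [ (S , n , S∈LD , refl) ]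

  Learner : Set
  Learner = Observation → Hypothesis m

  Learns : Learner → Set
  Learns M = ∀ S (S∈LD : LD S) a →
    (∃[ N ] ∀ n → N ≤ n → M (observe S S∈LD n) ≡ just a) ⇔ (S ≅ member K a)

  -- A partial recursive function computes M if it agrees with M on the domain
  -- of M; nothing is required of it at other inputs.

  ComputableLearner : Learner → Set
  ComputableLearner M =
    ∃[ φ ] ∀ o → φ [ codeDiagram (value o) ∷ [] ]⇓ codeHypothesis (M o)

  Learnable : Set
  Learnable = ∃[ M ] Learns M

  ComputablyLearnable : Set
  ComputablyLearnable = ∃[ M ] (ComputableLearner M × Learns M)

{-# OPTIONS --safe #-}

-- The structures are disjoint unions of classes, each with a set of labels that shows itself
-- only by enumeration.  Say that j halts if program j stops on input j with value 0.  A and B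
-- share infinitely many copies of certain classes: one with all labels and, for each n, one
-- with the label suc n, the labels suc j for j halting, and the label 0 if n halts.  In
-- addition A has a class whose labels are the suc j for j halting, and B one whose only label
-- is 0.  No class of A has its labels among those of the additional class of B, and
-- conversely; so in the limit a learner finds out which additional class is present.
--
-- Suppose that a computable learner M identifies both.  Given a finite part of A and n, put
-- the label suc n into the additional class, and add a new class that shows only the label 0,
-- until n halts, when it gets all labels.  This yields a copy C n of A if n halts and of B
-- otherwise.  If M never said B on C n for a halting n, then halting would be decidable: wait
-- until n halts or M says B.  So some finite extension within A of the given part makes M say
-- B, and iterating this yields a copy of A on which M says B infinitely often.

module Submission where

open import Defs
open import Axiom.ExcludedMiddle using (ExcludedMiddle)
open import Data.Product using (Σ-syntax; _×_)
open import Level using (0ℓ)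
open import Relation.Nullary using (¬_)

open import Data.Bool using (Bool; true; false; T)
open import Data.Bool.Properties using (T?)
open import Data.Empty using (⊥)
open import Data.Fin using (Fin; zero; suc; #_; toℕ; _↑ʳ_)
open import Data.Fin.Properties using (toℕ-injective)
open import Data.List
  using (List; []; _∷_; foldr; upTo; applyUpTo; map; filter; allFin; cartesianProductWith)
open import Data.List.Membership.Propositional using (_∈_; lose)
open import Data.List.Membership.Propositional.Properties
open import Data.List.Properties using (foldr-++; foldr-map; foldr-cong)
open import Data.List.Relation.Unary.Any using (here; there; satisfied)
open import Data.Maybe using (just; nothing)
open import Data.Maybe.Properties using (just-injective)
open import Data.Nat
open import Data.Nat.Properties
open import Data.Product using (∃-syntax; ∃₂; _,_; proj₁; proj₂)
open import Data.Refinement using (value; _,_)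
open import Data.Sum using (_⊎_; inj₁; inj₂)
open import Data.Unit using (tt)
open import Data.Vec using (Vec; []; _∷_; _++_; lookup; tabulate)
open import Data.Vec.Properties using (lookup-++ʳ; tabulate∘lookup; tabulate-cong)
open import Data.Vec.Relation.Binary.Pointwise.Inductive using (Pointwise; []; _∷_)
open import Function using (_∘_; id; flip)
open import Function.Bundles using (_↔_; _⇔_; mk⇔; mk↔ₛ′; module Inverse; module Equivalence)
open import Function.Construct.Identity using (↔-id)
open import Relation.Binary.PropositionalEquality
open import Relation.Nullary using (Dec; yes; no; contradiction)
open import Relation.Nullary.Decidable using (does-⇔)

-- Total functions with programs

record Fn (n : ℕ) : Set where
  field
    ⟦_⟧      : Vec ℕ n → ℕ
    program  : Rec n
    computes : ∀ xs → program [ xs ]⇓ ⟦_⟧ xs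

open Fn

-- Keeps the program and swaps in a pointwise equal function that is easier to reason about, so that
-- later equations hold by `refl` or by a congruence.
respell : ∀ {n} (f : Fn n) (g : Vec ℕ n → ℕ) → (∀ xs → ⟦ f ⟧ xs ≡ g xs) → Fn n
respell f g eq = record
  { ⟦_⟧ = g
  ; program = program f
  ; computes = λ xs → subst (program f [ xs ]⇓_) (eq xs) (computes f xs) }

var : ∀ {n} → Fin n → Fn n
var i = record { ⟦_⟧ = λ xs → lookup xs i ; program = proj i ; computes = λ xs → ⇓proj i }

evals : ∀ {m n} → Vec (Fn n) m → Vec ℕ n → Vec ℕ m
evals []       xs = []
evals (g ∷ gs) xs = ⟦ g ⟧ xs ∷ evals gs xs

infixr 9 _⊙_

_⊙_ : ∀ {m n} → Fn m → Vec (Fn n) m → Fn n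
f ⊙ gs = record
  { ⟦_⟧ = λ xs → ⟦ f ⟧ (evals gs xs)
  ; program = comp (program f) (programs gs)
  ; computes = λ xs → ⇓comp (computeAll gs xs) (computes f (evals gs xs)) }
  where
  programs : ∀ {m n} → Vec (Fn n) m → Vec (Rec n) m
  programs []       = []
  programs (g ∷ gs) = program g ∷ programs gs
  computeAll : ∀ {m n} (gs : Vec (Fn n) m) xs →
               Pointwise (λ g y → g [ xs ]⇓ y) (programs gs) (evals gs xs)
  computeAll []       xs = []
  computeAll (g ∷ gs) xs = computes g xs ∷ computeAll gs xs

recurse : ∀ {n} → (Vec ℕ n → ℕ) → (Vec ℕ (2 + n) → ℕ) → Vec ℕ (suc n) → ℕ
recurse f g (zero ∷ xs)  = f xs
recurse f g (suc k ∷ xs) = g (k ∷ recurse f g (k ∷ xs) ∷ xs)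

primrec : ∀ {n} → Fn n → Fn (2 + n) → Fn (suc n)
primrec f g = record
  { ⟦_⟧ = recurse ⟦ f ⟧ ⟦ g ⟧
  ; program = prim (program f) (program g)
  ; computes = computes-rec }
  where
  computes-rec : ∀ xs → prim (program f) (program g) [ xs ]⇓ recurse ⟦ f ⟧ ⟦ g ⟧ xs
  computes-rec (zero ∷ xs)  = ⇓prim-zero (computes f xs)
  computes-rec (suc k ∷ xs) = ⇓prim-suc (computes-rec (k ∷ xs)) (computes g _)

sucᶠ : ∀ {n} → Fn n → Fn n
sucᶠ f = successor ⊙ (f ∷ [])
  where
  successor : Fn 1
  successor = record
    { ⟦_⟧ = λ { (x ∷ []) → suc x } ; program = sucᴿ ; computes = λ { (x ∷ []) → ⇓suc } }

lit : ∀ {n} → ℕ → Fn n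
lit {n} k = respell (numeral k) (λ _ → k) (numeral-value k)
  where
  numeral : ℕ → Fn n
  numeral zero    = record { ⟦_⟧ = λ _ → 0 ; program = zeroᴿ ; computes = λ _ → ⇓zero }
  numeral (suc k) = sucᶠ (numeral k)
  numeral-value : ∀ k xs → ⟦ numeral k ⟧ xs ≡ k
  numeral-value zero    xs = refl
  numeral-value (suc k) xs = cong suc (numeral-value k xs)

predᶠ : ∀ {n} → Fn n → Fn n
predᶠ f = respell (primrec (lit 0) (var (# 0)) ⊙ (f ∷ [])) (λ xs → pred (⟦ f ⟧ xs))
  (λ xs → eq (⟦ f ⟧ xs))
  where
  eq : ∀ k → recurse (λ _ → 0) (λ xs → lookup xs (# 0)) (k ∷ []) ≡ pred k
  eq zero    = refl
  eq (suc k) = refl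

infixl 6 _+ᶠ_ _∸ᶠ_

_+ᶠ_ : ∀ {n} → Fn n → Fn n → Fn n
f +ᶠ g = respell (plus ⊙ (f ∷ g ∷ [])) (λ xs → ⟦ f ⟧ xs + ⟦ g ⟧ xs)
  (λ xs → eq (⟦ f ⟧ xs) (⟦ g ⟧ xs))
  where
  plus : Fn 2
  plus = primrec (var (# 0)) (sucᶠ (var (# 1)))
  eq : ∀ k x → ⟦ plus ⟧ (k ∷ x ∷ []) ≡ k + x
  eq zero    x = refl
  eq (suc k) x = cong suc (eq k x)

_∸ᶠ_ : ∀ {n} → Fn n → Fn n → Fn n
f ∸ᶠ g = respell (minus ⊙ (g ∷ f ∷ [])) (λ xs → ⟦ f ⟧ xs ∸ ⟦ g ⟧ xs)
  (λ xs → eq (⟦ g ⟧ xs) (⟦ f ⟧ xs))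
  where
  minus : Fn 2
  minus = primrec (var (# 0)) (predᶠ (var (# 1)))
  eq : ∀ k x → ⟦ minus ⟧ (k ∷ x ∷ []) ≡ x ∸ k
  eq zero    x = refl
  eq (suc k) x = trans (cong pred (eq k x)) (pred[m∸n]≡m∸[1+n] x k)

ifz : ℕ → ℕ → ℕ → ℕ
ifz zero    a b = a
ifz (suc _) a b = b

ifzᶠ : ∀ {n} → Fn n → Fn n → Fn n → Fn n
ifzᶠ f g h = respell (branch ⊙ (f ∷ g ∷ h ∷ []))
  (λ xs → ifz (⟦ f ⟧ xs) (⟦ g ⟧ xs) (⟦ h ⟧ xs)) (λ xs → eq (⟦ f ⟧ xs) (⟦ g ⟧ xs) (⟦ h ⟧ xs))
  where
  branch : Fn 3
  branch = primrec (var (# 0)) (var (# 3))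
  eq : ∀ c a b → ⟦ branch ⟧ (c ∷ a ∷ b ∷ []) ≡ ifz c a b
  eq zero    a b = refl
  eq (suc c) a b = refl

bit : Bool → ℕ
bit false = 0
bit true  = 1

infix 4 _≡ᶠ_

_≡ᶠ_ : ∀ {n} → Fn n → Fn n → Fn n
f ≡ᶠ g = respell (lit 1 ∸ᶠ ((f ∸ᶠ g) +ᶠ (g ∸ᶠ f))) (λ xs → bit (⟦ f ⟧ xs ≡ᵇ ⟦ g ⟧ xs))
  (λ xs → eq (⟦ f ⟧ xs) (⟦ g ⟧ xs))
  where
  eq : ∀ a b → 1 ∸ ((a ∸ b) + (b ∸ a)) ≡ bit (a ≡ᵇ b)
  eq zero    zero    = refl
  eq zero    (suc b) = 0∸n≡0 b
  eq (suc a) zero    = 0∸n≡0 (a + 0)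
  eq (suc a) (suc b) = eq a b

-- The Cantor pairing and its inverses

triangleᶠ : ∀ {n} → Fn n → Fn n
triangleᶠ f = respell (tri ⊙ (f ∷ [])) (λ xs → triangle (⟦ f ⟧ xs)) (λ xs → eq (⟦ f ⟧ xs))
  where
  tri : Fn 1
  tri = primrec (lit 0) (sucᶠ (var (# 0)) +ᶠ var (# 1))
  eq : ∀ k → ⟦ tri ⟧ (k ∷ []) ≡ triangle k
  eq zero    = refl
  eq (suc k) = cong (suc k +_) (eq k)

pairᶠ : ∀ {n} → Fn n → Fn n → Fn n
pairᶠ f g = respell (triangleᶠ (f +ᶠ g) +ᶠ g) (λ xs → pair (⟦ f ⟧ xs) (⟦ g ⟧ xs)) (λ _ → refl)

-- An opaque copy of pair, since unfolding nested pairs is costly.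

opaque

  pairing : Fn 2
  pairing = pairᶠ (var (# 0)) (var (# 1))

⟨_,_⟩ : ℕ → ℕ → ℕ
⟨ x , y ⟩ = ⟦ pairing ⟧ (x ∷ y ∷ [])

⟨_,_⟩ᶠ : ∀ {n} → Fn n → Fn n → Fn n
⟨ f , g ⟩ᶠ = pairing ⊙ (f ∷ g ∷ [])

opaque

  unfolding pairing

  ⟨⟩≡pair : ∀ x y → ⟨ x , y ⟩ ≡ pair x y
  ⟨⟩≡pair x y = refl

-- diagonal z is the d with triangle d ≤ z < triangle (suc d).

diagonalᶠ : Fn 1
diagonalᶠ = primrec (lit 0)
  (ifzᶠ (triangleᶠ (sucᶠ (var (# 1))) ∸ᶠ sucᶠ (var (# 0))) (sucᶠ (var (# 1))) (var (# 1)))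

diagonal : ℕ → ℕ
diagonal z = ⟦ diagonalᶠ ⟧ (z ∷ [])

diagonal-bounds : ∀ z → triangle (diagonal z) ≤ z × z < triangle (suc (diagonal z))
diagonal-bounds zero = z≤n , s≤s z≤n
diagonal-bounds (suc z) with diagonal z | diagonal-bounds z
... | d | lo , hi with triangle (suc d) ∸ suc z in eq
... | zero  = m∸n≡0⇒m≤n eq , s≤s (≤-trans hi (m≤n+m (triangle (suc d)) (suc d)))
... | suc _ = m≤n⇒m≤1+n lo , ≰⇒> λ n≤m → 1+n≢0 (trans (sym eq) (m≤n⇒m∸n≡0 n≤m))

triangle-mono : ∀ {m n} → m ≤ n → triangle m ≤ triangle n
triangle-mono z≤n       = z≤n
triangle-mono (s≤s m≤n) = +-mono-≤ (s≤s m≤n) (triangle-mono m≤n)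

diagonal-unique : ∀ {z d} → triangle d ≤ z → z < triangle (suc d) → diagonal z ≡ d
diagonal-unique {z} {d} lo hi with diagonal-bounds z
... | lo′ , hi′ = ≤-antisym
  (≮⇒≥ λ lt → <-irrefl refl (<-≤-trans hi (≤-trans (triangle-mono lt) lo′)))
  (≮⇒≥ λ lt → <-irrefl refl (<-≤-trans hi′ (≤-trans (triangle-mono lt) lo)))

diagonal-pair : ∀ x y → diagonal (pair x y) ≡ x + y
diagonal-pair x y = diagonal-unique (m≤m+n _ _)
  (subst (_< triangle (suc (x + y))) (+-comm y (triangle (x + y)))
    (s≤s (+-monoˡ-≤ (triangle (x + y)) (m≤n+m y x))))

opaque

  unpairing₂ : Fn 1
  unpairing₂ = var (# 0) ∸ᶠ triangleᶠ diagonalᶠ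

  unpairing₁ : Fn 1
  unpairing₁ = diagonalᶠ ∸ᶠ unpairing₂

π₁ π₂ : ℕ → ℕ
π₁ z = ⟦ unpairing₁ ⟧ (z ∷ [])
π₂ z = ⟦ unpairing₂ ⟧ (z ∷ [])

π₁ᶠ π₂ᶠ : ∀ {n} → Fn n → Fn n
π₁ᶠ f = unpairing₁ ⊙ (f ∷ [])
π₂ᶠ f = unpairing₂ ⊙ (f ∷ [])

opaque

  unfolding pairing unpairing₁

  π₂-⟨⟩ : ∀ x y → π₂ ⟨ x , y ⟩ ≡ y
  π₂-⟨⟩ x y rewrite diagonal-pair x y = m+n∸m≡n (triangle (x + y)) y

  π₁-⟨⟩ : ∀ x y → π₁ ⟨ x , y ⟩ ≡ x
  π₁-⟨⟩ x y rewrite π₂-⟨⟩ x y | diagonal-pair x y = m+n∸n≡m x y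

  ⟨π₁,π₂⟩ : ∀ z → ⟨ π₁ z , π₂ z ⟩ ≡ z
  ⟨π₁,π₂⟩ z with diagonal-bounds z
  ... | lo , hi = trans (cong (λ d → triangle d + π₂ z) (m∸n+n≡m π₂≤diagonal)) (m+[n∸m]≡n lo)
    where
    π₂≤diagonal : π₂ z ≤ diagonal z
    π₂≤diagonal = m≤n+o⇒m∸n≤o z (triangle (diagonal z))
      (subst (z ≤_) (+-comm (diagonal z) _) (s≤s⁻¹ hi))

⟨⟩-injective : ∀ {x y x′ y′} → ⟨ x , y ⟩ ≡ ⟨ x′ , y′ ⟩ → x ≡ x′ × y ≡ y′
⟨⟩-injective {x} {y} {x′} {y′} eq =
  trans (sym (π₁-⟨⟩ x y)) (trans (cong π₁ eq) (π₁-⟨⟩ x′ y′)) ,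
  trans (sym (π₂-⟨⟩ x y)) (trans (cong π₂ eq) (π₂-⟨⟩ x′ y′))

y≤⟨x,y⟩ : ∀ x y → y ≤ ⟨ x , y ⟩
y≤⟨x,y⟩ x y = subst (y ≤_) (sym (⟨⟩≡pair x y)) (m≤n+m y _)

-- A stack machine: a state is ⟨ v , K ⟩, where v is the current value and K codes the list
-- of instructions still to be applied to it.  A program is an instruction, so that the state
-- in which p is about to be run on xs consists of the value xs and the stack p ∷ K.

cons : ℕ → ℕ → ℕ
cons x xs = suc ⟨ x , xs ⟩

hd tl : ℕ → ℕ
hd v = π₁ (pred v)
tl v = π₂ (pred v)

consᶠ : ∀ {n} → Fn n → Fn n → Fn n
consᶠ f g = sucᶠ ⟨ f , g ⟩ᶠ

hdᶠ tlᶠ : ∀ {n} → Fn n → Fn n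
hdᶠ f = π₁ᶠ (predᶠ f)
tlᶠ f = π₂ᶠ (predᶠ f)

encode : ∀ {n} → Rec n → ℕ
encodes : ∀ {m n} → Vec (Rec n) m → ℕ
encode zeroᴿ       = ⟨ 0 , 0 ⟩
encode sucᴿ        = ⟨ 1 , 0 ⟩
encode (proj i)    = ⟨ 2 , toℕ i ⟩
encode (comp f gs) = ⟨ 3 , ⟨ encode f , encodes gs ⟩ ⟩
encode (prim f g)  = ⟨ 5 , ⟨ encode f , encode g ⟩ ⟩
encode (μ f)       = ⟨ 6 , encode f ⟩
-- The code of `zeroᴿ` serves here too, as the empty tuple is the value 0.
encodes []         = ⟨ 0 , 0 ⟩
encodes (g ∷ gs)   = ⟨ 4 , ⟨ encode g , encodes gs ⟩ ⟩

switchᶠ : ∀ {n} → Fn n → List (Fn n) → Fn n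
switchᶠ f []       = lit 0
switchᶠ f (g ∷ gs) = ifzᶠ f g (switchᶠ (predᶠ f) gs)

-- Beside the programs, there are instructions that resume an interrupted evaluation:
-- 7 and 8 that of a tuple, 9 that of a primitive recursion and 10 that of a minimisation.

opaque

  executeᶠ : Fn 4
  executeᶠ = switchᶠ (var (# 0))
    ( ⟨ lit 0 , K ⟩ᶠ
    ∷ ⟨ sucᶠ (hdᶠ v) , K ⟩ᶠ
    ∷ ifzᶠ p ⟨ hdᶠ v , K ⟩ᶠ ⟨ tlᶠ v , consᶠ ⟨ lit 2 , predᶠ p ⟩ᶠ K ⟩ᶠ
    ∷ ⟨ v , consᶠ (π₂ᶠ p) (consᶠ (π₁ᶠ p) K) ⟩ᶠ
    -- The tail of a tuple is evaluated first: 7 keeps the head program and the input meanwhile, and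
    -- 8 then keeps the finished tail.
    ∷ ⟨ v , consᶠ (π₂ᶠ p) (consᶠ ⟨ lit 7 , ⟨ π₁ᶠ p , v ⟩ᶠ ⟩ᶠ K) ⟩ᶠ
    ∷ ifzᶠ (hdᶠ v) (⟨ tlᶠ v , consᶠ (π₁ᶠ p) K ⟩ᶠ)
        (⟨ v⁻ , consᶠ ⟨ lit 5 , p ⟩ᶠ (consᶠ ⟨ lit 9 , ⟨ π₂ᶠ p , v⁻ ⟩ᶠ ⟩ᶠ K) ⟩ᶠ)
    ∷ minimise p (consᶠ (lit 0) v)
    ∷ ⟨ π₂ᶠ p , consᶠ (π₁ᶠ p) (consᶠ ⟨ lit 8 , v ⟩ᶠ K) ⟩ᶠ
    ∷ ⟨ consᶠ v p , K ⟩ᶠ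
    ∷ ⟨ consᶠ (hdᶠ (π₂ᶠ p)) (consᶠ v (tlᶠ (π₂ᶠ p))) , consᶠ (π₁ᶠ p) K ⟩ᶠ
    ∷ ifzᶠ v (⟨ hdᶠ (π₂ᶠ p) , K ⟩ᶠ)
        (minimise (π₁ᶠ p) (consᶠ (sucᶠ (hdᶠ (π₂ᶠ p))) (tlᶠ (π₂ᶠ p))))
    ∷ [])
    where
    p v K v⁻ : Fn 4
    p  = var (# 1)
    v  = var (# 2)
    K  = var (# 3)
    v⁻ = consᶠ (predᶠ (hdᶠ v)) (tlᶠ v)
    minimise : Fn 4 → Fn 4 → Fn 4
    minimise f l = ⟨ l , consᶠ f (consᶠ ⟨ lit 10 , ⟨ f , l ⟩ᶠ ⟩ᶠ K) ⟩ᶠ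

execute : ℕ → ℕ → ℕ → ℕ → ℕ
execute t p v K = ⟦ executeᶠ ⟧ (t ∷ p ∷ v ∷ K ∷ [])

opaque

  stepᶠ : Fn 1
  -- A state with empty stack is final and stays fixed, so that running longer does not change a
  -- result.
  stepᶠ = ifzᶠ (π₂ᶠ z) z (executeᶠ ⊙ (π₁ᶠ i ∷ π₂ᶠ i ∷ π₁ᶠ z ∷ tlᶠ (π₂ᶠ z) ∷ []))
    where
    z i : Fn 1
    z = var (# 0)
    i = hdᶠ (π₂ᶠ z)

step : ℕ → ℕ
step z = ⟦ stepᶠ ⟧ (z ∷ [])

runᶠ : Fn 2
runᶠ = primrec (var (# 0)) (stepᶠ ⊙ (var (# 1) ∷ []))

run : ℕ → ℕ → ℕ
run t z = ⟦ runᶠ ⟧ (t ∷ z ∷ [])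

opaque

  unfolding stepᶠ

  step-execute : ∀ t p v K → step ⟨ v , cons ⟨ t , p ⟩ K ⟩ ≡ execute t p v K
  step-execute t p v K = begin
    next (π₂ z) (π₁ z)                                     ≡⟨ cong₂ next (π₂-⟨⟩ v _) (π₁-⟨⟩ v _) ⟩
    execute (π₁ (π₁ ⟨ i , K ⟩)) (π₂ (π₁ ⟨ i , K ⟩)) v (π₂ ⟨ i , K ⟩)
      ≡⟨ cong₂ (λ i K → execute (π₁ i) (π₂ i) v K) (π₁-⟨⟩ i K) (π₂-⟨⟩ i K) ⟩
    execute (π₁ i) (π₂ i) v K
      ≡⟨ cong₂ (λ t p → execute t p v K) (π₁-⟨⟩ t p) (π₂-⟨⟩ t p) ⟩
    execute t p v K                                        ∎
    where
    open ≡-Reasoning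
    i z : ℕ
    i = ⟨ t , p ⟩
    z = ⟨ v , cons i K ⟩
    next : ℕ → ℕ → ℕ
    next K v = ifz K z (execute (π₁ (hd K)) (π₂ (hd K)) v (tl K))

  step-final : ∀ v → step ⟨ v , 0 ⟩ ≡ ⟨ v , 0 ⟩
  step-final v = cong next (π₂-⟨⟩ v 0)
    where
    next : ℕ → ℕ
    next K = ifz K ⟨ v , 0 ⟩ (execute (π₁ (hd K)) (π₂ (hd K)) (π₁ ⟨ v , 0 ⟩) (tl K))

run-final : ∀ t v → run t ⟨ v , 0 ⟩ ≡ ⟨ v , 0 ⟩
run-final zero    v = refl
run-final (suc t) v = trans (cong step (run-final t v)) (step-final v)

run-+ : ∀ s t z → run (s + t) z ≡ run s (run t z)
run-+ zero    t z = refl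
run-+ (suc s) t z = cong step (run-+ s t z)

infix 4 _⟶*_

_⟶*_ : ℕ → ℕ → Set
z ⟶* z′ = ∃[ t ] run t z ≡ z′

⟶*-trans : ∀ {x y z} → x ⟶* y → y ⟶* z → x ⟶* z
⟶*-trans {x} (s , refl) (t , refl) = t + s , run-+ t s x

⟶-step : ∀ {t p v K z z′} → execute t p v K ≡ z → z ⟶* z′ →
         ⟨ v , cons ⟨ t , p ⟩ K ⟩ ⟶* z′
⟶-step {t} {p} {v} {K} eq = ⟶*-trans (1 , trans (step-execute t p v K) eq)

⟶*-refl : ∀ {z} → z ⟶* z
⟶*-refl = 0 , refl

tuple : ∀ {n} → Vec ℕ n → ℕ
tuple []       = 0
tuple (x ∷ xs) = cons x (tuple xs)

opaque

  unfolding executeᶠ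

  execute-zero : ∀ v K → execute 0 0 v K ≡ ⟨ 0 , K ⟩
  execute-zero v K = refl

  execute-suc : ∀ x K → execute 1 0 (cons x 0) K ≡ ⟨ suc x , K ⟩
  execute-suc x K rewrite π₁-⟨⟩ x 0 = refl

  execute-tuple-resume : ∀ ys y K → execute 8 ys y K ≡ ⟨ cons y ys , K ⟩
  execute-tuple-resume ys y K = refl

  execute-μ : ∀ f v K → execute 6 f v K ≡
    ⟨ cons 0 v , cons f (cons ⟨ 10 , ⟨ f , cons 0 v ⟩ ⟩ K) ⟩
  execute-μ f v K = refl

  execute-proj-zero : ∀ x xs K → execute 2 0 (cons x xs) K ≡ ⟨ x , K ⟩
  execute-proj-zero x xs K rewrite π₁-⟨⟩ x xs = refl

  execute-proj-suc : ∀ i x xs K →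
    execute 2 (suc i) (cons x xs) K ≡ ⟨ xs , cons ⟨ 2 , i ⟩ K ⟩
  execute-proj-suc i x xs K rewrite π₂-⟨⟩ x xs = refl

  execute-comp : ∀ f gs v K → execute 3 ⟨ f , gs ⟩ v K ≡ ⟨ v , cons gs (cons f K) ⟩
  execute-comp f gs v K rewrite π₁-⟨⟩ f gs | π₂-⟨⟩ f gs = refl

  execute-tuple : ∀ g gs v K →
    execute 4 ⟨ g , gs ⟩ v K ≡ ⟨ v , cons gs (cons ⟨ 7 , ⟨ g , v ⟩ ⟩ K) ⟩
  execute-tuple g gs v K rewrite π₁-⟨⟩ g gs | π₂-⟨⟩ g gs = refl

  execute-prim-zero : ∀ f g xs K → execute 5 ⟨ f , g ⟩ (cons 0 xs) K ≡ ⟨ xs , cons f K ⟩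
  execute-prim-zero f g xs K rewrite π₁-⟨⟩ f g | π₁-⟨⟩ 0 xs | π₂-⟨⟩ 0 xs = refl

  execute-prim-suc : ∀ f g k xs K → execute 5 ⟨ f , g ⟩ (cons (suc k) xs) K ≡
    ⟨ cons k xs , cons ⟨ 5 , ⟨ f , g ⟩ ⟩ (cons ⟨ 9 , ⟨ g , cons k xs ⟩ ⟩ K) ⟩
  execute-prim-suc f g k xs K
    rewrite π₂-⟨⟩ f g | π₁-⟨⟩ (suc k) xs | π₂-⟨⟩ (suc k) xs = refl

  execute-tuple-head : ∀ g xs v K →
    execute 7 ⟨ g , xs ⟩ v K ≡ ⟨ xs , cons g (cons ⟨ 8 , v ⟩ K) ⟩
  execute-tuple-head g xs v K rewrite π₁-⟨⟩ g xs | π₂-⟨⟩ g xs = refl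

  execute-prim-resume : ∀ g k xs y K →
    execute 9 ⟨ g , cons k xs ⟩ y K ≡ ⟨ cons k (cons y xs) , cons g K ⟩
  execute-prim-resume g k xs y K
    rewrite π₁-⟨⟩ g (cons k xs) | π₂-⟨⟩ g (cons k xs) | π₁-⟨⟩ k xs | π₂-⟨⟩ k xs = refl

  execute-μ-found : ∀ f k xs K → execute 10 ⟨ f , cons k xs ⟩ 0 K ≡ ⟨ k , K ⟩
  execute-μ-found f k xs K rewrite π₂-⟨⟩ f (cons k xs) | π₁-⟨⟩ k xs = refl

  execute-μ-next : ∀ f k xs y K → execute 10 ⟨ f , cons k xs ⟩ (suc y) K ≡
    ⟨ cons (suc k) xs , cons f (cons (⟨ 10 , ⟨ f , cons (suc k) xs ⟩ ⟩) K) ⟩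
  execute-μ-next f k xs y K
    rewrite π₁-⟨⟩ f (cons k xs) | π₂-⟨⟩ f (cons k xs) | π₁-⟨⟩ k xs | π₂-⟨⟩ k xs = refl

-- Induction on the evaluation. The rest `K` of the stack is arbitrary because a subprogram runs on
-- top of the instructions that resume its caller.
simulate : ∀ {n} {p : Rec n} {xs y} → p [ xs ]⇓ y →
           ∀ K → ⟨ tuple xs , cons (encode p) K ⟩ ⟶* ⟨ y , K ⟩
simulateAll : ∀ {m n} {gs : Vec (Rec n) m} {xs ys} → Pointwise (λ g y → g [ xs ]⇓ y) gs ys →
              ∀ K → ⟨ tuple xs , cons (encodes gs) K ⟩ ⟶* ⟨ tuple ys , K ⟩

simulate (⇓zero {xs = xs}) K = ⟶-step (execute-zero (tuple xs) K) ⟶*-refl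
simulate (⇓suc {x}) K = ⟶-step (execute-suc x K) ⟶*-refl
simulate (⇓proj {xs = xs} i) K = project xs i
  where
  project : ∀ {n} (xs : Vec ℕ n) i →
            ⟨ tuple xs , cons ⟨ 2 , toℕ i ⟩ K ⟩ ⟶* ⟨ lookup xs i , K ⟩
  project (x ∷ xs) zero    = ⟶-step (execute-proj-zero x (tuple xs) K) ⟶*-refl
  project (x ∷ xs) (suc i) = ⟶-step (execute-proj-suc (toℕ i) x (tuple xs) K) (project xs i)
simulate (⇓comp {f = f} {gs} {xs} gs⇓ f⇓) K =
  ⟶-step (execute-comp (encode f) (encodes gs) (tuple xs) K)
    (⟶*-trans (simulateAll gs⇓ _) (simulate f⇓ K))
simulate (⇓prim-zero {f = f} {g} {xs} f⇓) K =
  ⟶-step (execute-prim-zero (encode f) (encode g) (tuple xs) K) (simulate f⇓ K)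
simulate (⇓prim-suc {f = f} {g} {k} {xs} {y} rec⇓ g⇓) K =
  ⟶-step (execute-prim-suc (encode f) (encode g) k (tuple xs) K)
    (⟶*-trans (simulate rec⇓ _)
      (⟶-step (execute-prim-resume (encode g) k (tuple xs) y K) (simulate g⇓ K)))
simulate (⇓μ {f = f} {xs} {k} f⇓ below) K =
  ⟶-step (execute-μ (encode f) (tuple xs) K) (from 0 k refl)
  where
  loop : ℕ → ℕ
  loop j = ⟨ cons j (tuple xs) ,
             cons (encode f) (cons ⟨ 10 , ⟨ encode f , cons j (tuple xs) ⟩ ⟩ K) ⟩
  -- Induction on the number `r` of candidates that remain before the least zero `k`.
  from : ∀ j r → j + r ≡ k → loop j ⟶* ⟨ k , K ⟩
  from j zero eq rewrite trans (sym (+-identityʳ j)) eq =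
    ⟶*-trans (simulate f⇓ _) (⟶-step (execute-μ-found (encode f) k (tuple xs) K) ⟶*-refl)
  from j (suc r) eq =
    ⟶*-trans (simulate (proj₂ (below j (m+1+n≡o⇒m<o eq))) _)
      (⟶-step (execute-μ-next (encode f) j (tuple xs) _ K)
        (from (suc j) r (trans (sym (+-suc j r)) eq)))
    where
    m+1+n≡o⇒m<o : j + suc r ≡ k → j < k
    m+1+n≡o⇒m<o refl = m<m+n j z<s

simulateAll {xs = xs} [] K = ⟶-step (execute-zero (tuple xs) K) ⟶*-refl
simulateAll {gs = g ∷ gs} {xs} {y ∷ ys} (g⇓ ∷ gs⇓) K =
  ⟶-step (execute-tuple (encode g) (encodes gs) (tuple xs) K)
    (⟶*-trans (simulateAll gs⇓ _)
      (⟶-step (execute-tuple-head (encode g) (tuple xs) (tuple ys) K)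
        (⟶*-trans (simulate g⇓ _) (⟶-step (execute-tuple-resume (tuple ys) y K) ⟶*-refl))))

-- haltsᶠ is applied to (n, t) and tells whether the program coded by n, run on n, has stopped
-- with value 0 after t steps: the final state with value 0 is ⟨ 0 , 0 ⟩, which is the number 0.

start : ℕ → ℕ
start n = ⟨ cons n 0 , cons n 0 ⟩

haltsᶠ : ∀ {n} → Fn n → Fn n → Fn n
haltsᶠ n t = (runᶠ ⊙ (t ∷ ⟨ consᶠ n (lit 0) , consᶠ n (lit 0) ⟩ᶠ ∷ [])) ≡ᶠ lit 0

halts : ℕ → ℕ → ℕ
halts n t = bit (run t (start n) ≡ᵇ 0)

Halts : ℕ → Set
Halts n = ∃[ t ] halts n t ≡ 1

halts-intro : ∀ n t → run t (start n) ≡ ⟨ 0 , 0 ⟩ → halts n t ≡ 1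
halts-intro n t eq = cong (λ z → bit (z ≡ᵇ 0)) (trans eq (⟨⟩≡pair 0 0))

halts-elim : ∀ n t → halts n t ≡ 1 → run t (start n) ≡ ⟨ 0 , 0 ⟩
halts-elim n t h = trans (is-zero (run t (start n)) h) (sym (⟨⟩≡pair 0 0))
  where
  is-zero : ∀ z → bit (z ≡ᵇ 0) ≡ 1 → z ≡ 0
  is-zero zero _ = refl

halts-mono : ∀ {n s t} → s ≤ t → halts n s ≡ 1 → halts n t ≡ 1
halts-mono {n} {s} {t} s≤t h = halts-intro n t (begin
  run t (start n)                  ≡⟨ cong (λ u → run u (start n)) (m∸n+n≡m s≤t) ⟨
  run (t ∸ s + s) (start n)        ≡⟨ run-+ (t ∸ s) s (start n) ⟩
  run (t ∸ s) (run s (start n))    ≡⟨ cong (run (t ∸ s)) (halts-elim n s h) ⟩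
  run (t ∸ s) ⟨ 0 , 0 ⟩            ≡⟨ run-final (t ∸ s) 0 ⟩
  ⟨ 0 , 0 ⟩                        ∎)
  where open ≡-Reasoning

Halts-intro : ∀ {p : Rec 1} → p [ encode p ∷ [] ]⇓ 0 → Halts (encode p)
Halts-intro {p} p⇓ with simulate p⇓ 0
... | t , eq = t , halts-intro (encode p) t eq

-- The machine is deterministic and final states persist: after `s + t` steps it is in the final
-- state with value `y` and also in the one with value 0.
Halts-elim : ∀ {p : Rec 1} {y} → p [ encode p ∷ [] ]⇓ y → Halts (encode p) → y ≡ 0
Halts-elim {p} {y} p⇓ (s , h) with simulate p⇓ 0
... | t , eq = proj₁ (⟨⟩-injective (begin
  ⟨ y , 0 ⟩                   ≡⟨ run-final s y ⟨
  run s ⟨ y , 0 ⟩             ≡⟨ cong (run s) eq ⟨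
  run s (run t (start e))     ≡⟨ run-+ s t (start e) ⟨
  run (s + t) (start e)       ≡⟨ halts-elim e (s + t) (halts-mono {e} (m≤m+n s t) h) ⟩
  ⟨ 0 , 0 ⟩                   ∎))
  where
  open ≡-Reasoning
  e = encode p

-- Diagrams of uniformly computable structures

drops : ∀ k {n} → Vec (Fn (k + n)) n
drops k = tabulate (λ i → var (k ↑ʳ i))

evals-drops : ∀ {k n} (ys : Vec ℕ k) (xs : Vec ℕ n) → evals (drops k) (ys ++ xs) ≡ xs
evals-drops {k} ys xs = begin
  evals (drops k) (ys ++ xs)                    ≡⟨ evals-tabulate (λ i → k ↑ʳ i) ⟩
  tabulate (λ i → lookup (ys ++ xs) (k ↑ʳ i))   ≡⟨ tabulate-cong (lookup-++ʳ ys xs) ⟩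
  tabulate (lookup xs)                          ≡⟨ tabulate∘lookup xs ⟩
  xs                                            ∎
  where
  open ≡-Reasoning
  evals-tabulate : ∀ {m n} {zs : Vec ℕ n} (f : Fin m → Fin n) →
                   evals (tabulate (var ∘ f)) zs ≡ tabulate (lookup zs ∘ f)
  evals-tabulate {zero}  f = refl
  evals-tabulate {suc m} {zs = zs} f = cong (lookup zs (f zero) ∷_) (evals-tabulate (f ∘ suc))

applyUpTo-cong : ∀ {f g : ℕ → ℕ} → f ≗ g → ∀ n → applyUpTo f n ≡ applyUpTo g n
applyUpTo-cong eq zero    = refl
applyUpTo-cong eq (suc n) = cong₂ _∷_ (eq 0) (applyUpTo-cong (eq ∘ suc) n)

-- A right fold begins with the last index, whereas the recursion counts upwards; so round `j`
-- handles the index `bound ∸ suc j`, and after `j` rounds the last `j` indices have been folded.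
foldᶠ : ∀ {n} → Fn n → Fn n → Fn (2 + n) → Fn n
foldᶠ {n} bound z body = respell (loop ⊙ (bound ∷ drops 0))
  (λ xs → foldr (λ i w → ⟦ body ⟧ (i ∷ w ∷ xs)) (⟦ z ⟧ xs) (upTo (⟦ bound ⟧ xs)))
  (λ xs → trans (cong (λ ys → ⟦ loop ⟧ (⟦ bound ⟧ xs ∷ ys)) (evals-drops [] xs))
    (loop-foldr xs (⟦ bound ⟧ xs) 0 refl))
  where
  next : Fn (2 + n)
  next = body ⊙ (((bound ⊙ drops 2) ∸ᶠ sucᶠ (var (# 0))) ∷ var (# 1) ∷ drops 2)
  loop : Fn (suc n)
  loop = primrec z next
  loop-foldr : ∀ xs j a → a + j ≡ ⟦ bound ⟧ xs → ⟦ loop ⟧ (j ∷ xs) ≡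
    foldr (λ i w → ⟦ body ⟧ (i ∷ w ∷ xs)) (⟦ z ⟧ xs) (applyUpTo (a +_) j)
  loop-foldr xs zero    a eq = refl
  loop-foldr xs (suc j) a eq = begin
    ⟦ loop ⟧ (suc j ∷ xs)
      ≡⟨ cong (λ ys → ⟦ body ⟧ ((⟦ bound ⟧ ys ∸ suc j) ∷ w ∷ ys)) (evals-drops (j ∷ w ∷ []) xs) ⟩
    ⟦ body ⟧ ((⟦ bound ⟧ xs ∸ suc j) ∷ w ∷ xs)
      ≡⟨ cong₂ (λ i w → ⟦ body ⟧ (i ∷ w ∷ xs))
           (trans (cong (_∸ suc j) (sym eq)) (trans (m+n∸n≡m a (suc j)) (sym (+-identityʳ a))))
           (loop-foldr xs j (suc a) (trans (sym (+-suc a j)) eq)) ⟩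
    step′ (a + 0) (foldr step′ (⟦ z ⟧ xs) (applyUpTo (suc a +_) j))
      ≡⟨ cong (λ l → step′ (a + 0) (foldr step′ (⟦ z ⟧ xs) l))
           (applyUpTo-cong (λ i → sym (+-suc a i)) j) ⟩
    step′ (a + 0) (foldr step′ (⟦ z ⟧ xs) (applyUpTo (λ i → a + suc i) j)) ∎
    where
    open ≡-Reasoning
    w = ⟦ loop ⟧ (j ∷ xs)
    step′ : ℕ → ℕ → ℕ
    step′ i w = ⟦ body ⟧ (i ∷ w ∷ xs)

𝕃 : Signature
𝕃 = record { size = 2 ; arity = λ _ → 2 }

link : Fin 2 → ℕ → ℕ → Bool
link zero       s t = π₁ s ≡ᵇ π₁ t
link (suc zero) s t = π₂ s ≡ᵇ pred (π₂ t)

-- Every element of a structure has a type, the code of the pair of a class and a label.  The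
-- first relation is equality of classes, the second one relates each label to the next, and
-- label 0 to itself, so that the labels are determined by the isomorphism type.

Str : (ℕ → ℕ) → Structure 𝕃
Str τ i (a ∷ b ∷ []) = link i (τ a) (τ b)

linkᶠ : ∀ {n} → Fin 2 → Fn n → Fn n → Fn n
linkᶠ {n} i f g = respell (comparison i) (λ xs → bit (link i (⟦ f ⟧ xs) (⟦ g ⟧ xs))) (correct i)
  where
  comparison : Fin 2 → Fn n
  comparison zero       = π₁ᶠ f ≡ᶠ π₁ᶠ g
  comparison (suc zero) = π₂ᶠ f ≡ᶠ predᶠ (π₂ᶠ g)
  correct : ∀ i xs → ⟦ comparison i ⟧ xs ≡ bit (link i (⟦ f ⟧ xs) (⟦ g ⟧ xs))
  correct zero       xs = refl
  correct (suc zero) xs = refl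

push : Structure 𝕃 → Atom 𝕃 → ℕ → ℕ
push S φ w = ifz (bit (holds S φ)) w (suc (pair (codeAtom φ) w))

-- Turns the coded diagram into a numerical fold over all atoms, which nested primitive recursions
-- can compute.
codeDiagram-filter : ∀ S φs →
  codeDiagram (filter (λ φ → T? (holds S φ)) φs) ≡ foldr (push S) 0 φs
codeDiagram-filter S []       = refl
codeDiagram-filter S (φ ∷ φs) with holds S φ
... | true  = cong (λ w → ℕ.suc (pair (codeAtom φ) w)) (codeDiagram-filter S φs)
... | false = codeDiagram-filter S φs

foldr-product : ∀ {A B C D : Set} (f : C → D → D) (g : A → B → C) z xs ys →
  foldr f z (cartesianProductWith g xs ys) ≡ foldr (λ a w → foldr (λ b → f (g a b)) w ys) z xs
foldr-product f g z []       ys = refl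
foldr-product f g z (x ∷ xs) ys =
  trans (foldr-++ f z (map (g x) ys) _)
    (trans (foldr-map f (g x) _ ys)
      (cong (λ w → foldr (λ b → f (g x b)) w ys) (foldr-product f g z xs ys)))

sweep : (ℕ → ℕ → ℕ → ℕ) → ℕ → List ℕ → ℕ
sweep f z xs = foldr (λ a w → foldr (f a) w xs) z xs

foldr-relation : ∀ S i z xs → foldr (push S) z (map (rel i) (tuples xs 2)) ≡
  sweep (λ a b → push S (rel i (a ∷ b ∷ []))) z xs
foldr-relation S i z xs =
  trans (foldr-map (push S) (rel i) z (tuples xs 2))
    (trans (foldr-product (push S ∘ rel i) _∷_ z xs (tuples xs 1))
      (foldr-cong (λ a w → foldr-product (λ v → push S (rel i (a ∷ v))) _∷_ w xs _) refl xs))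

-- A right fold handles a concatenation from its end, so the last block of `atomsOver` becomes the
-- innermost sweep.
codeDiagram-sweep : ∀ S n → codeDiagram (S ↾ n) ≡
  (let xs = upTo (suc n) in
   sweep (λ a b → push S (a ≐ b))
     (sweep (λ a b → push S (rel (# 0) (a ∷ b ∷ [])))
       (sweep (λ a b → push S (rel (# 1) (a ∷ b ∷ []))) 0 xs) xs) xs)
codeDiagram-sweep S n =
  trans (codeDiagram-filter S (atomsOver 𝕃 xs))
    (trans (foldr-++ (push S) 0 (cartesianProductWith _≐_ xs xs) _)
      (trans (foldr-product (push S) _≐_ _ xs xs)
        (cong (λ z → sweep (λ a b → push S (a ≐ b)) z xs)
          (trans (foldr-++ (push S) 0 (map (rel (# 0)) (tuples xs 2)) _)
            (trans (foldr-relation S (# 0) _ xs)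
              (cong (λ z → sweep (λ a b → push S (rel (# 0) (a ∷ b ∷ []))) z xs)
                (trans (foldr-++ (push S) 0 (map (rel (# 1)) (tuples xs 2)) _)
                  (foldr-relation S (# 1) _ xs))))))))
  where
  xs = upTo (suc n)

sweepᶠ : Fn 5 → Fn 2 → Fn 2
sweepᶠ f z = respell
  -- The innermost arguments are in turn `b`, the inner accumulator, `a`, the outer accumulator, `n`
  -- and `k`.
  (foldᶠ (sucᶠ (var (# 0))) z (foldᶠ (sucᶠ (var (# 2))) (var (# 1))
    (f ⊙ (var (# 2) ∷ var (# 0) ∷ var (# 1) ∷ var (# 4) ∷ var (# 5) ∷ []))))
  (λ { (n ∷ k ∷ []) →
    sweep (λ a b w → ⟦ f ⟧ (a ∷ b ∷ w ∷ n ∷ k ∷ [])) (⟦ z ⟧ (n ∷ k ∷ [])) (upTo (suc n)) })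
  (λ { (n ∷ k ∷ []) → refl })

module _ (τ : Fn 2) where

  structure : ℕ → Structure 𝕃
  structure k = Str (λ i → ⟦ τ ⟧ (i ∷ k ∷ []))

  private
    pushᶠ : Fn 5 → Fn 5 → Fn 5
    pushᶠ test code = ifzᶠ test (var (# 2)) (sucᶠ (pairᶠ code (var (# 2))))

    equalᶠ : Fn 5
    equalᶠ = respell
      (pushᶠ (var (# 0) ≡ᶠ var (# 1)) (pairᶠ (lit 0) (pairᶠ (var (# 0)) (var (# 1)))))
      (λ { (a ∷ b ∷ w ∷ n ∷ k ∷ []) → push (structure k) (a ≐ b) w })
      (λ { (a ∷ b ∷ w ∷ n ∷ k ∷ []) → refl })

    relationᶠ : Fin 2 → Fn 5
    relationᶠ i = respell
      (pushᶠ (linkᶠ i (type (# 0)) (type (# 1)))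
        (pairᶠ (lit (suc (toℕ i)))
          (sucᶠ (pairᶠ (var (# 0)) (sucᶠ (pairᶠ (var (# 1)) (lit 0)))))))
      (λ { (a ∷ b ∷ w ∷ n ∷ k ∷ []) → push (structure k) (rel i (a ∷ b ∷ [])) w })
      (λ { (a ∷ b ∷ w ∷ n ∷ k ∷ []) → refl })
      where
      type : Fin 5 → Fn 5
      type j = τ ⊙ (var j ∷ var (# 4) ∷ [])

  diagramᶠ : Fn 2
  diagramᶠ = respell (sweepᶠ equalᶠ (sweepᶠ (relationᶠ (# 0)) (sweepᶠ (relationᶠ (# 1)) (lit 0))))
    (λ { (n ∷ k ∷ []) → codeDiagram (structure k ↾ n) })
    (λ { (n ∷ k ∷ []) → sym (codeDiagram-sweep (structure k) n) })

-- Back and forth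

Infinitely : (ℕ → Set) → Set
Infinitely P = ∀ m → ∃[ a ] (m ≤ a × P a)

record Matching (R : ℕ → ℕ → Set) (a₀ b₀ : ℕ) : Set₁ where
  field
    graph      : ℕ → ℕ → Set
    bound      : ℕ
    base       : graph a₀ b₀
    sound      : ∀ {a b} → graph a b → R a b
    functional : ∀ {a b b′} → graph a b → graph a b′ → b ≡ b′
    injective  : ∀ {a a′ b} → graph a b → graph a′ b → a ≡ a′
    bounded    : ∀ {a b} → graph a b → a < bound × b < bound

open Matching

infix 4 _⊑_

_⊑_ : ∀ {R a₀ b₀} → Matching R a₀ b₀ → Matching R a₀ b₀ → Set
M ⊑ M′ = ∀ {a b} → graph M a b → graph M′ a b

transpose : ∀ {R a₀ b₀} → Matching R a₀ b₀ → Matching (flip R) b₀ a₀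
transpose M = record
  { graph = flip (graph M) ; bound = bound M ; base = base M ; sound = sound M
  ; functional = injective M ; injective = functional M
  ; bounded = λ g → proj₂ (bounded M g) , proj₁ (bounded M g) }

singleton : ∀ {R a₀ b₀} → R a₀ b₀ → Matching R a₀ b₀
singleton {R} {a₀} {b₀} r = record
  { graph = λ a b → a ≡ a₀ × b ≡ b₀ ; bound = suc (a₀ + b₀) ; base = refl , refl
  ; sound = λ { (refl , refl) → r }
  ; functional = λ (_ , p) (_ , q) → trans p (sym q)
  ; injective = λ (p , _) (q , _) → trans p (sym q)
  ; bounded = λ { (refl , refl) → s≤s (m≤m+n a₀ b₀) , s≤s (m≤n+m b₀ a₀) } }

-- `W c k` says that the class `c` has the label `k`. As each such type occurs infinitely often and
-- no other occurs, `W` determines the structure up to isomorphism.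
record Presents (W : ℕ → ℕ → Set) (τ : ℕ → ℕ) : Set where
  field
    valid     : ∀ a → W (π₁ (τ a)) (π₂ (τ a))
    recurrent : ∀ c k → W c k → Infinitely (λ a → τ a ≡ ⟨ c , k ⟩)

open Presents

module _ (em : ExcludedMiddle 0ℓ) where

  extend : ∀ {R a₀ b₀} → (∀ {a} → a ≢ a₀ → Infinitely (R a)) → (M : Matching R a₀ b₀) (a : ℕ) →
           Σ[ M′ ∈ Matching R a₀ b₀ ] (M ⊑ M′ × ∃[ b ] graph M′ a b)
  extend {R} {a₀} {b₀} forth M a with em {∃[ b ] graph M a b}
  ... | yes matched = M , id , matched
  ... | no ¬matched
    with forth (λ a≡a₀ → ¬matched (b₀ , subst (λ a → graph M a b₀) (sym a≡a₀) (base M))) (bound M)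
  ... | b , fresh , r = record
    { graph = λ x y → graph M x y ⊎ (x ≡ a × y ≡ b)
    ; bound = suc (bound M + (a + b))
    ; base = inj₁ (base M)
    ; sound = λ { (inj₁ g) → sound M g ; (inj₂ (refl , refl)) → r }
    ; functional = λ
      { (inj₁ g) (inj₁ h) → functional M g h
      ; (inj₁ g) (inj₂ (refl , _)) → contradiction (_ , g) ¬matched
      ; (inj₂ (refl , _)) (inj₁ h) → contradiction (_ , h) ¬matched
      ; (inj₂ (_ , p)) (inj₂ (_ , q)) → trans p (sym q) }
    ; injective = λ
      { (inj₁ g) (inj₁ h) → injective M g h
      ; (inj₁ g) (inj₂ (_ , refl)) → contradiction (proj₂ (bounded M g)) (≤⇒≯ fresh)
      ; (inj₂ (_ , refl)) (inj₁ h) → contradiction (proj₂ (bounded M h)) (≤⇒≯ fresh)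
      ; (inj₂ (p , _)) (inj₂ (q , _)) → trans p (sym q) }
    ; bounded = λ
      { (inj₁ g) → m≤n⇒m≤1+n (≤-trans (proj₁ (bounded M g)) (m≤m+n _ _)) ,
                   m≤n⇒m≤1+n (≤-trans (proj₂ (bounded M g)) (m≤m+n _ _))
      ; (inj₂ (refl , refl)) → s≤s (≤-trans (m≤m+n a b) (m≤n+m _ (bound M))) ,
                               s≤s (≤-trans (m≤n+m b a) (m≤n+m _ (bound M))) }
    } , inj₁ , b , inj₂ (refl , refl)

  -- Round `n` matches `n` on both sides. That the two maps are inverse is seen at a common later
  -- stage, whose graph is functional and injective. The lemma serves for elements and again for
  -- classes.
  back-and-forth : ∀ {R a₀ b₀} → R a₀ b₀ →
    (∀ {a} → a ≢ a₀ → Infinitely (R a)) → (∀ {b} → b ≢ b₀ → Infinitely (flip R b)) →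
    Σ[ f ∈ ℕ ↔ ℕ ] ∀ a → R a (Inverse.to f a)
  back-and-forth {R} {a₀} {b₀} r forth back =
    mk↔ₛ′ to from to∘from from∘to , λ a → sound (stage (suc a)) (to-graph a)
    where
    next : ℕ → Matching R a₀ b₀ → Matching R a₀ b₀
    next n M = transpose (proj₁ (extend back (transpose (proj₁ (extend forth M n))) n))

    stage : ℕ → Matching R a₀ b₀
    stage zero    = singleton r
    stage (suc n) = next n (stage n)

    half : ∀ n → Σ[ M ∈ Matching R a₀ b₀ ] (stage n ⊑ M × ∃[ b ] graph M n b)
    half n = extend forth (stage n) n

    whole : ∀ n → Σ[ M ∈ Matching (flip R) b₀ a₀ ]
            (transpose (proj₁ (half n)) ⊑ M × ∃[ a ] graph M n a)
    whole n = extend back (transpose (proj₁ (half n))) n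

    stage-suc : ∀ n → stage n ⊑ stage (suc n)
    stage-suc n g = proj₁ (proj₂ (whole n)) (proj₁ (proj₂ (half n)) g)

    stage-+ : ∀ m n → stage n ⊑ stage (m + n)
    stage-+ zero    n g = g
    stage-+ (suc m) n g = stage-suc (m + n) (stage-+ m n g)

    to from : ℕ → ℕ
    to a   = proj₁ (proj₂ (proj₂ (half a)))
    from b = proj₁ (proj₂ (proj₂ (whole b)))

    to-graph : ∀ a → graph (stage (suc a)) a (to a)
    to-graph a = proj₁ (proj₂ (whole a)) (proj₂ (proj₂ (proj₂ (half a))))

    from-graph : ∀ b → graph (stage (suc b)) (from b) b
    from-graph b = proj₂ (proj₂ (proj₂ (whole b)))

    common : ∀ {a b a′ b′} m n → graph (stage m) a b → graph (stage n) a′ b′ →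
             graph (stage (m + n)) a b × graph (stage (m + n)) a′ b′
    common {a} {b} m n g h =
      subst (λ k → graph (stage k) a b) (+-comm n m) (stage-+ n m g) , stage-+ m n h

    to∘from : ∀ b → to (from b) ≡ b
    to∘from b with common (suc (from b)) (suc b) (to-graph (from b)) (from-graph b)
    ... | g , h = functional (stage (suc (from b) + suc b)) g h

    from∘to : ∀ a → from (to a) ≡ a
    from∘to a with common (suc (to a)) (suc a) (from-graph (to a)) (to-graph a)
    ... | g , h = injective (stage (suc (to a) + suc a)) g h

  -- Elements are matched type by type along the renaming of classes. The relations survive because
  -- they see only equality of classes, which the injective `ρ` preserves, and labels, which do not
  -- change.
  presents⇒≅ : ∀ {W₁ W₂ τ₁ τ₂} → Presents W₁ τ₁ → Presents W₂ τ₂ →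
    (ρ : ℕ ↔ ℕ) → (∀ c k → W₁ c k ⇔ W₂ (Inverse.to ρ c) k) → Str τ₁ ≅ Str τ₂
  presents⇒≅ {W₁} {W₂} {τ₁} {τ₂} P₁ P₂ ρ same =
    proj₁ bijection , λ { i (a ∷ b ∷ []) → preserves i (proj₂ bijection a) (proj₂ bijection b) }
    where
    open Inverse ρ renaming (to to rename; from to unrename)

    Renames : ℕ → ℕ → Set
    Renames s t = π₁ t ≡ rename (π₁ s) × π₂ t ≡ π₂ s

    forth : ∀ a → Infinitely (λ b → Renames (τ₁ a) (τ₂ b))
    forth a m with recurrent P₂ _ _ (Equivalence.to (same _ _) (valid P₁ a)) m
    ... | b , m≤b , eq = b , m≤b , trans (cong π₁ eq) (π₁-⟨⟩ _ _) , trans (cong π₂ eq) (π₂-⟨⟩ _ _)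

    back : ∀ b → Infinitely (λ a → Renames (τ₁ a) (τ₂ b))
    back b m with recurrent P₁ _ _ (Equivalence.from (same (unrename (π₁ (τ₂ b))) (π₂ (τ₂ b)))
                    (subst (λ c → W₂ c (π₂ (τ₂ b))) (sym (strictlyInverseˡ _)) (valid P₂ b))) m
    ... | a , m≤a , eq = a , m≤a ,
      sym (trans (cong rename (trans (cong π₁ eq) (π₁-⟨⟩ _ _))) (strictlyInverseˡ _)) ,
      sym (trans (cong π₂ eq) (π₂-⟨⟩ _ _))

    bijection : Σ[ f ∈ ℕ ↔ ℕ ] ∀ a → Renames (τ₁ a) (τ₂ (Inverse.to f a))
    -- No pair is distinguished here, so 0 and any partner of it make the base.
    bijection = back-and-forth {a₀ = 0} (proj₂ (proj₂ (forth 0 0)))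
      (λ {a} _ → forth a) (λ {b} _ → back b)

    preserves : ∀ i {s s′ t t′} → Renames s t → Renames s′ t′ → link i s s′ ≡ link i t t′
    preserves zero {s} {s′} (c , _) (c′ , _) rewrite c | c′ =
      does-⇔ (mk⇔ (cong rename) (λ eq →
        trans (sym (strictlyInverseʳ _)) (trans (cong unrename eq) (strictlyInverseʳ _))))
        (π₁ s ≟ π₁ s′) (rename (π₁ s) ≟ rename (π₁ s′))
    preserves (suc zero) (_ , k) (_ , k′) rewrite k | k′ = refl

-- An enumerator e presents, for each n, the sets of labels
-- { k ∣ e (c , k , t , n) = 1 for some stage t } of the classes c.

stageOf : Fn 4 → ℕ → ℕ → ℕ → ℕ → ℕ
stageOf e n c k t = ⟦ e ⟧ (c ∷ k ∷ t ∷ n ∷ [])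

record Enumerates (e : Fn 4) (n c k : ℕ) : Set where
  constructor _at_
  field
    stage      : ℕ
    enumerated : stageOf e n c k stage ≡ 1

Monotone : (ℕ → ℕ) → Set
Monotone f = ∀ {s t} → s ≤ t → f s ≡ 1 → f t ≡ 1

-- The element ⟨ T , t ⟩ has type T, provided T is enumerated by stage t, and otherwise
-- the type with class 1 and label 0.

1ᶜ : ℕ
1ᶜ = suc ⟨ 0 , 0 ⟩

opaque

  typesᶠ : Fn 4 → Fn 2
  typesᶠ e = ifzᶠ ((e ⊙ (π₁ᶠ claimed ∷ π₂ᶠ claimed ∷ π₂ᶠ (var (# 0)) ∷ var (# 1) ∷ [])) ≡ᶠ lit 1)
    ⟨ lit 1ᶜ , lit 0 ⟩ᶠ claimed
    where
    claimed : Fn 2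
    claimed = π₁ᶠ (var (# 0))

types : Fn 4 → ℕ → ℕ → ℕ
types e n i = ⟦ typesᶠ e ⟧ (i ∷ n ∷ [])

opaque

  unfolding typesᶠ

  types-valid : ∀ e n → Enumerates e n 1ᶜ 0 →
                ∀ i → Enumerates e n (π₁ (types e n i)) (π₂ (types e n i))
  types-valid e n default i = select (stageOf e n (π₁ claimed) (π₂ claimed) (π₂ i)) refl
    where
    claimed : ℕ
    claimed = π₁ i
    chosen : ℕ → ℕ
    chosen v = ifz (bit (v ≡ᵇ 1)) ⟨ 1ᶜ , 0 ⟩ claimed
    is-default : Enumerates e n (π₁ ⟨ 1ᶜ , 0 ⟩) (π₂ ⟨ 1ᶜ , 0 ⟩)
    is-default rewrite π₁-⟨⟩ 1ᶜ 0 | π₂-⟨⟩ 1ᶜ 0 = default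
    select : ∀ v → stageOf e n (π₁ claimed) (π₂ claimed) (π₂ i) ≡ v →
             Enumerates e n (π₁ (chosen v)) (π₂ (chosen v))
    select 0             eq = is-default
    select 1             eq = π₂ i at eq
    select (suc (suc _)) eq = is-default

  types-element : ∀ e n {c k t} → stageOf e n c k t ≡ 1 → types e n ⟨ ⟨ c , k ⟩ , t ⟩ ≡ ⟨ c , k ⟩
  types-element e n {c} {k} {t} eq
    rewrite π₁-⟨⟩ ⟨ c , k ⟩ t | π₂-⟨⟩ ⟨ c , k ⟩ t | π₁-⟨⟩ c k | π₂-⟨⟩ c k | eq = refl

-- What is enumerated stays enumerated, so each later stage gives another element of the same type.
types-recurrent : ∀ e n → (∀ c k → Monotone (stageOf e n c k)) →
  ∀ c k → Enumerates e n c k → Infinitely (λ i → types e n i ≡ ⟨ c , k ⟩)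
types-recurrent e n mono c k (t at eq) m =
  ⟨ ⟨ c , k ⟩ , t ⊔ m ⟩ ,
  ≤-trans (m≤n⊔m t m) (y≤⟨x,y⟩ ⟨ c , k ⟩ (t ⊔ m)) ,
  types-element e n (mono c k (m≤m⊔n t m) eq)

-- Only finitely many values of `τ` enter, as constants of the program, so `τ` itself may be any
-- function.
prefixᶠ : (ℕ → ℕ) → ℕ → Fn 2 → Fn 2
prefixᶠ τ zero    f = f
prefixᶠ τ (suc l) f = ifzᶠ (var (# 0) ≡ᶠ lit l) (prefixᶠ τ l f) (lit (τ l))

≡ᵇ-refl : ∀ n → bit (n ≡ᵇ n) ≡ 1
≡ᵇ-refl zero    = refl
≡ᵇ-refl (suc n) = ≡ᵇ-refl n

≢⇒≡ᵇ : ∀ {m n} → m ≢ n → bit (m ≡ᵇ n) ≡ 0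
≢⇒≡ᵇ {zero}  {zero}  m≢n = contradiction refl m≢n
≢⇒≡ᵇ {zero}  {suc n} m≢n = refl
≢⇒≡ᵇ {suc m} {zero}  m≢n = refl
≢⇒≡ᵇ {suc m} {suc n} m≢n = ≢⇒≡ᵇ (m≢n ∘ cong suc)

prefix-< : ∀ τ l f n {i} → i < l → ⟦ prefixᶠ τ l f ⟧ (i ∷ n ∷ []) ≡ τ i
prefix-< τ (suc l) f n {i} i<l with i ≟ l
... | yes refl rewrite ≡ᵇ-refl i = refl
... | no i≢l rewrite ≢⇒≡ᵇ i≢l = prefix-< τ l f n (≤∧≢⇒< (s≤s⁻¹ i<l) i≢l)

prefix-≥ : ∀ τ l f n {i} → l ≤ i → ⟦ prefixᶠ τ l f ⟧ (i ∷ n ∷ []) ≡ ⟦ f ⟧ (i ∷ n ∷ [])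
prefix-≥ τ zero    f n l≤i = refl
prefix-≥ τ (suc l) f n {i} l<i rewrite ≢⇒≡ᵇ (λ i≡l → <-irrefl (sym i≡l) l<i) =
  prefix-≥ τ l f n (<⇒≤ l<i)

ifz-mono : ∀ c {f g} → Monotone f → Monotone g → Monotone (λ t → ifz c (f t) (g t))
ifz-mono zero    f↑ g↑ = f↑
ifz-mono (suc c) f↑ g↑ = g↑

const-mono : ∀ c → Monotone (λ _ → c)
const-mono c _ eq = eq

-- Class 0 is special.  Class suc ⟨ m , j ⟩ is the j-th of infinitely many copies of the class
-- of kind m: that of kind 0 has all labels, that of kind suc n has the label suc n, all labels
-- suc j with j halting, and the label 0 if n halts.

opaque

  haltingᶠ kindᶠ Aᶠ Bᶠ : Fn 4
  haltingᶠ = ifzᶠ (var (# 1)) (lit 0) (haltsᶠ (predᶠ (var (# 1))) (var (# 2)))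
  kindᶠ = ifzᶠ m (lit 1)
    (ifzᶠ (var (# 1)) (haltsᶠ (predᶠ m) (var (# 2))) (ifzᶠ (var (# 1) ≡ᶠ m) haltingᶠ (lit 1)))
    where
    m : Fn 4
    m = π₁ᶠ (predᶠ (var (# 0)))
  Aᶠ = ifzᶠ (var (# 0)) haltingᶠ kindᶠ
  Bᶠ = ifzᶠ (var (# 0)) (ifzᶠ (var (# 1)) (lit 1) (lit 0)) kindᶠ

  -- Compared to A, class 0 gets the additional label suc n, while class J, a class of kind 0,
  -- has only the label 0 unless n halts.  So this presents A if n halts, and B otherwise.

  Cᶠ : ℕ → Fn 4
  Cᶠ J = ifzᶠ (var (# 0) ≡ᶠ lit J)
    (ifzᶠ (var (# 0)) (ifzᶠ (var (# 1) ≡ᶠ sucᶠ (var (# 3))) haltingᶠ (lit 1)) kindᶠ)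
    (ifzᶠ (var (# 1)) (lit 1) (haltsᶠ (var (# 3)) (var (# 2))))

haltingAt : ℕ → ℕ → ℕ
haltingAt k t = ifz k 0 (halts (pred k) t)

kindAt : ℕ → ℕ → ℕ → ℕ
kindAt m k t = ifz m 1 (ifz k (halts (pred m) t) (ifz (bit (k ≡ᵇ m)) (haltingAt k t) 1))

haltingAt-mono : ∀ k → Monotone (haltingAt k)
haltingAt-mono k = ifz-mono k (const-mono 0) (halts-mono {pred k})

kindAt-mono : ∀ m k → Monotone (kindAt m k)
kindAt-mono m k = ifz-mono m (const-mono 1)
  (ifz-mono k (halts-mono {pred m}) (ifz-mono (bit (k ≡ᵇ m)) (haltingAt-mono k) (const-mono 1)))

opaque

  unfolding Cᶠ

  A-special : ∀ k t → stageOf Aᶠ 0 0 k t ≡ haltingAt k t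
  A-special k t = refl

  A-kind : ∀ m j k t → stageOf Aᶠ 0 (suc ⟨ m , j ⟩) k t ≡ kindAt m k t
  A-kind m j k t = cong (λ m → kindAt m k t) (π₁-⟨⟩ m j)

  B-special : ∀ k t → stageOf Bᶠ 0 0 k t ≡ ifz k 1 0
  B-special k t = refl

  B-kind : ∀ m j k t → stageOf Bᶠ 0 (suc ⟨ m , j ⟩) k t ≡ kindAt m k t
  B-kind m j k t = cong (λ m → kindAt m k t) (π₁-⟨⟩ m j)

  C-at : ∀ J n k t → stageOf (Cᶠ J) n J k t ≡ ifz k 1 (halts n t)
  C-at J n k t = cong (λ v → ifz v (off J) (ifz k 1 (halts n t))) (≡ᵇ-refl J)
    where
    off : ℕ → ℕ
    off c = ifz c (ifz (bit (k ≡ᵇ suc n)) (haltingAt k t) 1) (kindAt (π₁ (pred c)) k t)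

  C-special : ∀ {J} → 0 ≢ J → ∀ n k t →
              stageOf (Cᶠ J) n 0 k t ≡ ifz (bit (k ≡ᵇ suc n)) (haltingAt k t) 1
  C-special 0≢J n k t =
    cong (λ v → ifz v (ifz (bit (k ≡ᵇ suc n)) (haltingAt k t) 1) (ifz k 1 (halts n t))) (≢⇒≡ᵇ 0≢J)

  C-kind : ∀ {J m j} → suc ⟨ m , j ⟩ ≢ J → ∀ n k t →
           stageOf (Cᶠ J) n (suc ⟨ m , j ⟩) k t ≡ kindAt m k t
  C-kind {J} {m} {j} c≢J n k t = trans
    (cong (λ v → ifz v (kindAt (π₁ ⟨ m , j ⟩) k t) (ifz k 1 (halts n t))) (≢⇒≡ᵇ c≢J))
    (cong (λ m → kindAt m k t) (π₁-⟨⟩ m j))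

  A-mono : ∀ c k → Monotone (stageOf Aᶠ 0 c k)
  A-mono c k = ifz-mono c (haltingAt-mono k) (kindAt-mono (π₁ (pred c)) k)

  B-mono : ∀ c k → Monotone (stageOf Bᶠ 0 c k)
  B-mono c k = ifz-mono c (const-mono (ifz k 1 0)) (kindAt-mono (π₁ (pred c)) k)

  C-mono : ∀ J n c k → Monotone (stageOf (Cᶠ J) n c k)
  C-mono J n c k = ifz-mono (bit (c ≡ᵇ J))
    (ifz-mono c (ifz-mono (bit (k ≡ᵇ suc n)) (haltingAt-mono k) (const-mono 1))
      (kindAt-mono (π₁ (pred c)) k))
    (ifz-mono k (const-mono 1) (halts-mono {n}))

enumerates-≗ : ∀ {e e′ n n′ c c′ k} {f : ℕ → ℕ} → stageOf e n c k ≗ f → stageOf e′ n′ c′ k ≗ f →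
               Enumerates e n c k ⇔ Enumerates e′ n′ c′ k
enumerates-≗ eq eq′ = mk⇔
  (λ (t at h) → t at trans (eq′ t) (trans (sym (eq t)) h))
  (λ (t at h) → t at trans (eq t) (trans (sym (eq′ t)) h))

𝒜 ℬ : ℕ → ℕ → Set
𝒜 = Enumerates Aᶠ 0
ℬ = Enumerates Bᶠ 0

A-types B-types : ℕ → ℕ
A-types = types Aᶠ 0
B-types = types Bᶠ 0

A-presents : Presents 𝒜 A-types
A-presents = record
  { valid = types-valid Aᶠ 0 (0 at A-kind 0 0 0 0)
  ; recurrent = types-recurrent Aᶠ 0 A-mono }

B-presents : Presents ℬ B-types
B-presents = record
  { valid = types-valid Bᶠ 0 (0 at B-kind 0 0 0 0)
  ; recurrent = types-recurrent Bᶠ 0 B-mono }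

class-cases : ∀ (P : ℕ → Set) → P 0 → (∀ m j → P (suc ⟨ m , j ⟩)) → ∀ c → P c
class-cases P special kind zero    = special
class-cases P special kind (suc c) = subst (λ c → P (suc c)) (⟨π₁,π₂⟩ c) (kind (π₁ c) (π₂ c))

-- Structures that are copies of A or B according to halting

module Dichotomy (b : ℕ) (τ : ℕ → ℕ) (l : ℕ)
  (τ-valid : ∀ i → 𝒜 (π₁ (τ i)) (π₂ (τ i))) (τ-bounded : ∀ {i} → i < l → π₁ (τ i) < b) where

  -- It exceeds `b`, hence is not a class of any element below `l`; it has kind 0, so that giving it
  -- all labels yields a class of A.
  fresh : ℕ
  fresh = suc ⟨ 0 , b ⟩

  C-typesᶠ : Fn 2
  C-typesᶠ = prefixᶠ τ l (typesᶠ (Cᶠ fresh))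

  C-types : ℕ → ℕ → ℕ
  C-types n i = ⟦ C-typesᶠ ⟧ (i ∷ n ∷ [])

  𝒞 : ℕ → ℕ → ℕ → Set
  𝒞 n = Enumerates (Cᶠ fresh) n

  0≢fresh : 0 ≢ fresh
  0≢fresh ()

  𝒜⊆𝒞 : ∀ n {c k} → c ≢ fresh → 𝒜 c k → 𝒞 n c k
  𝒜⊆𝒞 n {c} {k} = class-cases (λ c → c ≢ fresh → 𝒜 c k → 𝒞 n c k)
    (λ 0≢ (t at h) → t at trans (C-special 0≢ n k t)
      (extra (bit (k ≡ᵇ suc n)) (trans (sym (A-special k t)) h)))
    (λ m j c≢ → Equivalence.to (enumerates-≗ (A-kind m j k) (C-kind c≢ n k)))
    c
    where
    extra : ∀ v {h} → h ≡ 1 → ifz v h 1 ≡ 1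
    extra zero    h = h
    extra (suc v) h = refl

  -- The only extra label of class 0 is `suc n`, which that class has in A when `n` halts.
  𝒞⊆𝒜 : ∀ n → Halts n → ∀ {c k} → c ≢ fresh → 𝒞 n c k → 𝒜 c k
  𝒞⊆𝒜 n (s , halted) {c} {k} = class-cases (λ c → c ≢ fresh → 𝒞 n c k → 𝒜 c k)
    (λ 0≢ (t at h) → special k t (trans (sym (C-special 0≢ n k t)) h))
    (λ m j c≢ → Equivalence.from (enumerates-≗ (A-kind m j k) (C-kind c≢ n k)))
    c
    where
    special : ∀ k t → ifz (bit (k ≡ᵇ suc n)) (haltingAt k t) 1 ≡ 1 → 𝒜 0 k
    special k t h with k ≟ suc n
    ... | yes refl = s at trans (A-special (suc n) s) halted
    ... | no k≢ = t at trans (A-special k t)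
                    (trans (cong (λ v → ifz v (haltingAt k t) 1) (sym (≢⇒≡ᵇ k≢))) h)

  𝒞⇔𝒜 : ∀ n → Halts n → ∀ c k → 𝒞 n c k ⇔ 𝒜 c k
  𝒞⇔𝒜 n (s , halted) c k with c ≟ fresh
  ... | yes refl = mk⇔ (λ _ → 0 at A-kind 0 b k 0) (λ _ → s at trans (C-at fresh n k s) (all k))
    where
    all : ∀ k → ifz k 1 (halts n s) ≡ 1
    all zero    = refl
    all (suc k) = halted
  ... | no c≢fresh = mk⇔ (𝒞⊆𝒜 n (s , halted) c≢fresh) (𝒜⊆𝒞 n c≢fresh)

  -- The prescribed elements avoid the class `fresh`, and all other classes keep the labels that
  -- they have in A. Recurrence is untouched by finitely many elements.
  C-presents : ∀ n → Presents (𝒞 n) (C-types n)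
  C-presents n = record { valid = C-valid ; recurrent = C-recurrent }
    where
    b<fresh : b < fresh
    b<fresh = s≤s (y≤⟨x,y⟩ 0 b)

    default : 𝒞 n 1ᶜ 0
    default with 1ᶜ ≟ fresh
    ... | yes eq = subst (λ c → 𝒞 n c 0) (sym eq) (0 at C-at fresh n 0 0)
    ... | no ≢fresh = 0 at C-kind ≢fresh n 0 0

    Valid : ℕ → Set
    Valid T = 𝒞 n (π₁ T) (π₂ T)

    C-valid : ∀ i → 𝒞 n (π₁ (C-types n i)) (π₂ (C-types n i))
    C-valid i with i <? l
    ... | yes i<l = subst Valid (sym (prefix-< τ l (typesᶠ (Cᶠ fresh)) n i<l))
      (𝒜⊆𝒞 n (λ eq → <-irrefl eq (<-trans (τ-bounded i<l) b<fresh)) (τ-valid i))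
    ... | no i≮l = subst Valid (sym (prefix-≥ τ l (typesᶠ (Cᶠ fresh)) n (≮⇒≥ i≮l)))
      (types-valid (Cᶠ fresh) n default i)

    C-recurrent : ∀ c k → 𝒞 n c k → Infinitely (λ a → C-types n a ≡ ⟨ c , k ⟩)
    C-recurrent c k p m with types-recurrent (Cᶠ fresh) n (C-mono fresh n) c k p (m ⊔ l)
    ... | i , m⊔l≤i , eq = i , ≤-trans (m≤m⊔n m l) m⊔l≤i ,
      trans (prefix-≥ τ l (typesᶠ (Cᶠ fresh)) n (≤-trans (m≤n⊔m m l) m⊔l≤i)) eq

  module _ (em : ExcludedMiddle 0ℓ) (n : ℕ) where

    C≅A : Halts n → Str (C-types n) ≅ Str A-types
    C≅A halts = presents⇒≅ em (C-presents n) A-presents (↔-id ℕ) (𝒞⇔𝒜 n halts)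

    -- If `n` does not halt, class 0 has become one more class of kind `suc n`, and `fresh`, a class
    -- lost to kind 0, has the labels of class 0 of B. As each kind has infinitely many copies, a
    -- renaming of classes absorbs both changes.
    C≅B : ¬ Halts n → Str (C-types n) ≅ Str B-types
    C≅B ¬halts = presents⇒≅ em (C-presents n) B-presents (proj₁ renaming-of-classes)
      (λ c k → proj₂ renaming-of-classes c k)
      where
      SameLabels : ℕ → ℕ → Set
      SameLabels c d = ∀ k → 𝒞 n c k ⇔ ℬ d k

      same-kind : ∀ m j j′ → suc ⟨ m , j ⟩ ≢ fresh → SameLabels (suc ⟨ m , j ⟩) (suc ⟨ m , j′ ⟩)
      same-kind m j j′ c≢ k = enumerates-≗ (C-kind c≢ n k) (B-kind m j′ k)

      same-special : ∀ j → SameLabels 0 (suc ⟨ suc n , j ⟩)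
      same-special j zero = mk⇔
        (λ (t at h) → contradiction (trans (sym (C-special 0≢fresh n 0 t)) h) 0≢1+n)
        (λ (t at h) → contradiction (t , trans (sym (B-kind (suc n) j 0 t)) h) ¬halts)
      same-special j (suc k) =
        enumerates-≗ (C-special 0≢fresh n (suc k)) (B-kind (suc n) j (suc k))

      same-fresh : SameLabels fresh 0
      same-fresh zero    = enumerates-≗ (C-at fresh n 0) (B-special 0)
      same-fresh (suc k) = mk⇔
        (λ (t at h) → contradiction (t , trans (sym (C-at fresh n (suc k) t)) h) ¬halts)
        (λ (t at h) → contradiction (trans (sym (B-special (suc k) t)) h) 0≢1+n)

      forth : ∀ {c} → c ≢ fresh → Infinitely (SameLabels c)
      forth {c} c≢fresh m = class-cases (λ c → c ≢ fresh → ∃[ d ] (m ≤ d × SameLabels c d))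
        (λ _ → suc ⟨ suc n , m ⟩ , m≤n⇒m≤1+n (y≤⟨x,y⟩ (suc n) m) , same-special m)
        (λ m′ j c≢fresh → suc ⟨ m′ , m ⟩ , m≤n⇒m≤1+n (y≤⟨x,y⟩ m′ m) , same-kind m′ j m c≢fresh)
        c c≢fresh

      back : ∀ {d} → d ≢ 0 → Infinitely (flip SameLabels d)
      back {d} d≢0 m = class-cases (λ d → d ≢ 0 → ∃[ c ] (m ≤ c × SameLabels c d))
        (λ 0≢0 → contradiction refl 0≢0)
        -- An index above `b` keeps the class different from `fresh`.
        (λ m′ j _ → suc ⟨ m′ , m ⊔ suc b ⟩ ,
          m≤n⇒m≤1+n (≤-trans (m≤m⊔n m (suc b)) (y≤⟨x,y⟩ m′ (m ⊔ suc b))) ,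
          same-kind m′ (m ⊔ suc b) j (λ eq →
            <-irrefl (sym (proj₂ (⟨⟩-injective (suc-injective eq)))) (m≤n⊔m m (suc b))))
        d d≢0

      renaming-of-classes : Σ[ ρ ∈ ℕ ↔ ℕ ] ∀ c → SameLabels c (Inverse.to ρ c)
      renaming-of-classes = back-and-forth em same-fresh forth back

-- Computability of the atomic diagrams

module _ (τ : Fn 2) (n : ℕ) where

  private
    S : Structure 𝕃
    S = structure τ n

    testᶠ : Fin 2 → Fn 2
    -- Numbers that do not code a list of exactly two elements are rejected.
    testᶠ i = ifzᶠ (u ≡ᶠ consᶠ (hdᶠ u) (consᶠ (hdᶠ (tlᶠ u)) (lit 0))) (lit 0)
      (linkᶠ i (type (hdᶠ u)) (type (hdᶠ (tlᶠ u))))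
      where
      u : Fn 2
      u = var (# 1)
      type : Fn 2 → Fn 2
      type f = τ ⊙ (f ∷ lit n ∷ [])

    queryᶠ : Fn 2
    queryᶠ = switchᶠ (var (# 0))
      ((π₁ᶠ (var (# 1)) ≡ᶠ π₂ᶠ (var (# 1))) ∷ testᶠ (# 0) ∷ testᶠ (# 1) ∷ [])

    query : ℕ → ℕ → ℕ
    query t u = ⟦ queryᶠ ⟧ (t ∷ u ∷ [])

    answer : ℕ → ℕ
    answer x = query (π₁ x) (π₂ x)

    codeAtom-≐ : ∀ a b → codeAtom {𝕃} (a ≐ b) ≡ ⟨ 0 , ⟨ a , b ⟩ ⟩
    codeAtom-≐ a b = trans (cong (pair 0) (sym (⟨⟩≡pair a b))) (sym (⟨⟩≡pair 0 _))

    codeAtom-rel : ∀ i a b →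
      codeAtom {𝕃} (rel i (a ∷ b ∷ [])) ≡ ⟨ suc (toℕ i) , cons a (cons b 0) ⟩
    codeAtom-rel i a b = sym (trans (⟨⟩≡pair _ _) (cong (pair (suc (toℕ i)) ∘ suc)
      (trans (⟨⟩≡pair a _) (cong (pair a ∘ suc) (⟨⟩≡pair b 0)))))

    test : Fin 2 → ℕ → ℕ → ℕ → ℕ
    test i a b u = ifz (bit (u ≡ᵇ cons a (cons b 0))) 0 (bit (holds S (rel i (a ∷ b ∷ []))))

    query-test : ∀ i u → query (suc (toℕ i)) u ≡ test i (hd u) (hd (tl u)) u
    query-test zero       u = refl
    query-test (suc zero) u = refl

    query-rel : ∀ i a b →
      query (suc (toℕ i)) (cons a (cons b 0)) ≡ bit (holds S (rel i (a ∷ b ∷ [])))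
    query-rel i a b = trans (query-test i (cons a (cons b 0)))
      (trans (cong₂ (λ x y → test i x y (cons a (cons b 0))) (π₁-⟨⟩ a _)
               (trans (cong hd (π₂-⟨⟩ a _)) (π₁-⟨⟩ b 0)))
        (cong (λ v → ifz v 0 (bit (holds S (rel i (a ∷ b ∷ []))))) (≡ᵇ-refl (cons a (cons b 0)))))

    answer-codeAtom : ∀ φ → answer (codeAtom φ) ≡ bit (holds S φ)
    answer-codeAtom (a ≐ b) rewrite codeAtom-≐ a b = trans
      (cong₂ query (π₁-⟨⟩ 0 _) (π₂-⟨⟩ 0 _))
      (cong₂ (λ x y → bit (x ≡ᵇ y)) (π₁-⟨⟩ a b) (π₂-⟨⟩ a b))
    answer-codeAtom (rel i (a ∷ b ∷ [])) rewrite codeAtom-rel i a b =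
      trans (cong₂ query (π₁-⟨⟩ (suc (toℕ i)) _) (π₂-⟨⟩ (suc (toℕ i)) _)) (query-rel i a b)

    decode-rel : ∀ i u →
      (∃[ φ ] codeAtom {𝕃} φ ≡ ⟨ suc (toℕ i) , u ⟩) ⊎ query (suc (toℕ i)) u ≡ 0
    decode-rel i u with u ≟ cons (hd u) (cons (hd (tl u)) 0)
    ... | yes eq = inj₁ (rel i (hd u ∷ hd (tl u) ∷ []) ,
      trans (codeAtom-rel i (hd u) (hd (tl u))) (cong ⟨ suc (toℕ i) ,_⟩ (sym eq)))
    ... | no ≢u = inj₂ (trans (query-test i u)
      (cong (λ v → ifz v 0 (bit (holds S (rel i (hd u ∷ hd (tl u) ∷ []))))) (≢⇒≡ᵇ ≢u)))

    decode : ∀ t u → (∃[ φ ] codeAtom {𝕃} φ ≡ ⟨ t , u ⟩) ⊎ query t u ≡ 0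
    decode 0 u = inj₁ (π₁ u ≐ π₂ u , trans (codeAtom-≐ _ _) (cong ⟨ 0 ,_⟩ (⟨π₁,π₂⟩ u)))
    decode 1 u = decode-rel (# 0) u
    decode 2 u = decode-rel (# 1) u
    decode (suc (suc (suc t))) u = inj₂ refl

  structure-computable : ComputableStructure S
  structure-computable = program answerᶠ , decide
    where
    answerᶠ : Fn 1
    answerᶠ = queryᶠ ⊙ (π₁ᶠ (var (# 0)) ∷ π₂ᶠ (var (# 0)) ∷ [])

    true≢0 : ∀ b → T b → bit b ≢ 0
    true≢0 true _ ()

    decide : ∀ x → (AtomicDiagram S x × program answerᶠ [ x ∷ [] ]⇓ 1) ⊎
                   (¬ AtomicDiagram S x × program answerᶠ [ x ∷ [] ]⇓ 0)
    decide x with decode (π₁ x) (π₂ x)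
    ... | inj₂ answer≡0 = inj₂ (not-in ,
      subst (program answerᶠ [ x ∷ [] ]⇓_) answer≡0 (computes answerᶠ (x ∷ [])))
      where
      not-in : ¬ AtomicDiagram S x
      not-in (φ , h , refl) = true≢0 (holds S φ) h (trans (sym (answer-codeAtom φ)) answer≡0)
    ... | inj₁ (φ , eq) = by-truth (holds S φ) refl
      where
      code≡x : codeAtom φ ≡ x
      code≡x = trans eq (⟨π₁,π₂⟩ x)
      answer≡ : answer x ≡ bit (holds S φ)
      answer≡ = trans (cong answer (sym code≡x)) (answer-codeAtom φ)
      run-answer : ∀ {b} → holds S φ ≡ b → program answerᶠ [ x ∷ [] ]⇓ bit b
      run-answer h =
        subst (program answerᶠ [ x ∷ [] ]⇓_) (trans answer≡ (cong bit h)) (computes answerᶠ (x ∷ []))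
      by-truth : ∀ b → holds S φ ≡ b → _
      by-truth true  h = inj₁ ((φ , subst T (sym h) tt , code≡x) , run-answer h)
      -- Any atom `ψ` with code `x` has the truth value that the program computes at `x`, so it is
      -- false as well.
      by-truth false h = inj₂ ((λ (ψ , t , c) → true≢0 (holds S ψ) t
        (trans (sym (answer-codeAtom ψ)) (trans (cong answer c) (trans answer≡ (cong bit h))))) , run-answer h)

-- Finite substructures and their diagrams

data Below (n : ℕ) : Atom 𝕃 → Set where
  eqᵇ  : ∀ {a b} → a ≤ n → b ≤ n → Below n (a ≐ b)
  relᵇ : ∀ {i a b} → a ≤ n → b ≤ n → Below n (rel i (a ∷ b ∷ []))

∈-atomsOver⁺ : ∀ {n φ} → Below n φ → φ ∈ atomsOver 𝕃 (upTo (suc n))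
∈-atomsOver⁺ (eqᵇ a≤n b≤n) =
  ∈-++⁺ˡ (∈-cartesianProductWith⁺ _≐_ (∈-upTo⁺ (s≤s a≤n)) (∈-upTo⁺ (s≤s b≤n)))
∈-atomsOver⁺ {n} (relᵇ {i} a≤n b≤n) =
  ∈-++⁺ʳ (cartesianProductWith _≐_ (upTo (suc n)) (upTo (suc n)))
    (∈-concatMap⁺ (λ i → map (rel i) (tuples (upTo (suc n)) 2))
      (lose (∈-allFin i) (∈-map⁺ (rel i)
        (∈-cartesianProductWith⁺ _∷_ (∈-upTo⁺ (s≤s a≤n))
          (∈-cartesianProductWith⁺ _∷_ (∈-upTo⁺ (s≤s b≤n)) (here refl))))))

∈-tuples⁻ : ∀ {A : Set} (xs : List A) {x y} → (x ∷ y ∷ []) ∈ tuples xs 2 → x ∈ xs × y ∈ xs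
∈-tuples⁻ xs p with ∈-cartesianProductWith⁻ _∷_ xs (tuples xs 1) p
... | _ , _ , x∈ , q , refl with ∈-cartesianProductWith⁻ _∷_ xs (tuples xs 0) q
... | _ , _ , y∈ , _ , refl = x∈ , y∈

∈-atomsOver⁻ : ∀ {n φ} → φ ∈ atomsOver 𝕃 (upTo (suc n)) → Below n φ
∈-atomsOver⁻ {n} p with ∈-++⁻ (cartesianProductWith _≐_ (upTo (suc n)) (upTo (suc n))) p
... | inj₁ q with ∈-cartesianProductWith⁻ _≐_ (upTo (suc n)) (upTo (suc n)) q
...   | _ , _ , a∈ , b∈ , refl = eqᵇ (s≤s⁻¹ (∈-upTo⁻ a∈)) (s≤s⁻¹ (∈-upTo⁻ b∈))
∈-atomsOver⁻ {n} p | inj₂ q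
  with satisfied (∈-concatMap⁻ (λ i → map (rel i) (tuples (upTo (suc n)) 2)) {xs = allFin 2} q)
... | i , r with ∈-map⁻ (rel i) r
... | a ∷ b ∷ [] , s , refl with ∈-tuples⁻ (upTo (suc n)) s
... | a∈ , b∈ = relᵇ (s≤s⁻¹ (∈-upTo⁻ a∈)) (s≤s⁻¹ (∈-upTo⁻ b∈))

↾-cong : ∀ {S S′ : Structure 𝕃} n →
  (∀ i a b → a ≤ n → b ≤ n → S i (a ∷ b ∷ []) ≡ S′ i (a ∷ b ∷ [])) → S ↾ n ≡ S′ ↾ n
↾-cong {S} {S′} n agree =
  filter-agree (atomsOver 𝕃 (upTo (suc n))) (λ p → holds-agree (∈-atomsOver⁻ p))
  where
  holds-agree : ∀ {φ} → Below n φ → holds S φ ≡ holds S′ φ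
  holds-agree (eqᵇ _ _)         = refl
  holds-agree (relᵇ {i} a≤n b≤n) = agree i _ _ a≤n b≤n
  filter-agree : ∀ φs → (∀ {φ} → φ ∈ φs → holds S φ ≡ holds S′ φ) →
    filter (λ φ → T? (holds S φ)) φs ≡ filter (λ φ → T? (holds S′ φ)) φs
  filter-agree []       eq = refl
  filter-agree (φ ∷ φs) eq with holds S φ | holds S′ φ | eq (here refl)
  ... | true  | _ | refl = cong (φ ∷_) (filter-agree φs (eq ∘ there))
  ... | false | _ | refl = filter-agree φs (eq ∘ there)

-- The atoms `c ≐ c` show that the second domain contains the first; so a relation missing from the
-- common diagram is false in both structures.
↾-injective : ∀ (S S′ : Structure 𝕃) n n′ → S ↾ n ≡ S′ ↾ n′ →
  ∀ i a b → a ≤ n → b ≤ n → S i (a ∷ b ∷ []) ≡ S′ i (a ∷ b ∷ [])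
↾-injective S S′ n n′ eq i a b a≤n b≤n =
  T-equal (S i (a ∷ b ∷ [])) (S′ i (a ∷ b ∷ []))
    (λ t → proj₂ (∈↾⁻ S′ n′ (subst (rel i (a ∷ b ∷ []) ∈_) eq (∈↾⁺ S (relᵇ a≤n b≤n) t))))
    (λ t → proj₂ (∈↾⁻ S n
      (subst (rel i (a ∷ b ∷ []) ∈_) (sym eq) (∈↾⁺ S′ (relᵇ (≤n′ a≤n) (≤n′ b≤n)) t))))
  where
  T-equal : ∀ x y → (T x → T y) → (T y → T x) → x ≡ y
  T-equal true  true  _ _ = refl
  T-equal false false _ _ = refl
  T-equal true  false f _ = contradiction (f tt) id
  T-equal false true  _ g = contradiction (g tt) id
  ∈↾⁺ : ∀ S {n φ} → Below n φ → T (holds S φ) → φ ∈ S ↾ n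
  ∈↾⁺ S below t = ∈-filter⁺ (λ φ → T? (holds S φ)) (∈-atomsOver⁺ below) t
  ∈↾⁻ : ∀ S n {φ} → φ ∈ S ↾ n → Below n φ × T (holds S φ)
  ∈↾⁻ S n p with ∈-filter⁻ (λ φ → T? (holds S φ)) {xs = atomsOver 𝕃 (upTo (suc n))} p
  ... | q , t = ∈-atomsOver⁻ q , t
  ≤n′ : ∀ {c} → c ≤ n → c ≤ n′
  ≤n′ {c} c≤n with ∈↾⁻ S′ n′ (subst ((c ≐ c) ∈_) eq (∈↾⁺ S (eqᵇ c≤n c≤n) (≡⇒≡ᵇ c c refl)))
  ... | eqᵇ c≤n′ _ , _ = c≤n′

-- A learner

Eventually : (ℕ → Set) → Set
Eventually P = ∃[ N ] ∀ n → N ≤ n → P n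

eventually-≤ : ∀ {P : ℕ → ℕ → Set} → (∀ i → Eventually (λ n → P n i)) →
               ∀ m → Eventually (λ n → ∀ i → i ≤ m → P n i)
eventually-≤ {P} ev zero with ev 0
... | N , p = N , λ n N≤n i i≤0 → subst (P n) (sym (n≤0⇒n≡0 i≤0)) (p n N≤n)
eventually-≤ {P} ev (suc m) with eventually-≤ {P} ev m | ev (suc m)
... | N , p | N′ , q = N ⊔ N′ , λ n N⊔N′≤n i i≤m+1 →
  below n i (≤-trans (m≤m⊔n N N′) N⊔N′≤n) (≤-trans (m≤n⊔m N N′) N⊔N′≤n) (m≤n⇒m<n∨m≡n i≤m+1)
  where
  below : ∀ n i → N ≤ n → N′ ≤ n → i < suc m ⊎ i ≡ suc m → P n i
  below n i N≤n N′≤n (inj₁ i<m+1) = p n N≤n i (s≤s⁻¹ i<m+1)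
  below n i N≤n N′≤n (inj₂ refl)  = q n N′≤n

-- The data `F` are consistent with the labels in the class of `i` all lying in `Z`. Here `τ` ranges
-- over all assignments of types, so that only `F` matters.
Looks : (ℕ → Set) → FiniteDiagram 𝕃 → ℕ → Set
Looks Z F i = ∃₂ λ τ n → F ≡ Str τ ↾ n × (∀ j → π₁ (τ j) ≡ π₁ (τ i) → Z (π₂ (τ j)))

≡ᵇ-transfer : ∀ m n m′ n′ → (m ≡ᵇ n) ≡ (m′ ≡ᵇ n′) → m ≡ n → m′ ≡ n′
≡ᵇ-transfer m n m′ n′ eq m≡n = ≡ᵇ⇒≡ m′ n′ (subst T eq (≡⇒≡ᵇ m n m≡n))

module _ (τ τ′ : ℕ → ℕ) (n : ℕ)
  (agree : ∀ i a b → a ≤ n → b ≤ n → link i (τ a) (τ b) ≡ link i (τ′ a) (τ′ b)) where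

  classes-agree : ∀ {a b} → a ≤ n → b ≤ n → π₁ (τ a) ≡ π₁ (τ b) → π₁ (τ′ a) ≡ π₁ (τ′ b)
  classes-agree {a} {b} a≤n b≤n = ≡ᵇ-transfer (π₁ (τ a)) (π₁ (τ b)) (π₁ (τ′ a)) (π₁ (τ′ b))
    (agree (# 0) a b a≤n b≤n)

  successions-agree : ∀ {a b} → a ≤ n → b ≤ n →
                      π₂ (τ a) ≡ pred (π₂ (τ b)) ⇔ π₂ (τ′ a) ≡ pred (π₂ (τ′ b))
  successions-agree {a} {b} a≤n b≤n = mk⇔
    (≡ᵇ-transfer (π₂ (τ a)) (pred (π₂ (τ b))) (π₂ (τ′ a)) (pred (π₂ (τ′ b)))
      (agree (# 1) a b a≤n b≤n))
    (≡ᵇ-transfer (π₂ (τ′ a)) (pred (π₂ (τ′ b))) (π₂ (τ a)) (pred (π₂ (τ b)))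
      (sym (agree (# 1) a b a≤n b≤n)))

  -- A label is determined by a chain of smaller labels.

  labels-agree : ∀ k → (∀ l → l ≤ k → ∃[ c ] (c ≤ n × π₂ (τ c) ≡ l)) →
                 ∀ {c} → c ≤ n → π₂ (τ c) ≡ k → π₂ (τ′ c) ≡ k
  labels-agree zero chain {c} c≤n eq = self-loop (π₂ (τ′ c))
    (Equivalence.to (successions-agree c≤n c≤n) (trans eq (cong pred (sym eq))))
    where
    self-loop : ∀ k → k ≡ pred k → k ≡ 0
    self-loop zero    _  = refl
    self-loop (suc k) eq = contradiction eq 1+n≢n
  labels-agree (suc k) chain {c} c≤n eq with chain k (n≤1+n k)
  ... | c′ , c′≤n , eq′ = step-up (π₂ (τ′ c)) refl
    where
    predecessor : k ≡ pred (π₂ (τ′ c))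
    predecessor = trans (sym (labels-agree k (λ l l≤k → chain l (m≤n⇒m≤1+n l≤k)) c′≤n eq′))
      (Equivalence.to (successions-agree c′≤n c≤n) (trans eq′ (cong pred (sym eq))))
    step-up : ∀ v → π₂ (τ′ c) ≡ v → π₂ (τ′ c) ≡ suc k
    step-up (suc v) e = trans e (cong suc (sym (trans predecessor (cong pred e))))
    step-up zero    e = contradiction
      (trans (sym eq) (trans
        (Equivalence.from (successions-agree c≤n c≤n) (trans e (cong pred (sym e))))
        (cong pred eq))) 1+n≢n

-- Once `i`, `j` and elements with all labels up to that of `j` are visible, every assignment with
-- the same restriction puts `j` into the class of `i` and gives it the same label, which is not in
-- `Z`.
refutable : ∀ {Z : ℕ → Set} τ → (∀ k → ∃[ a ] π₂ (τ a) ≡ k) →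
  ∀ i j → π₁ (τ j) ≡ π₁ (τ i) → ¬ Z (π₂ (τ j)) → Eventually (λ n → ¬ Looks Z (Str τ ↾ n) i)
refutable {Z} τ full i j same-class ¬Zj with
  eventually-≤ {λ n l → ∃[ c ] (c ≤ n × π₂ (τ c) ≡ l)}
    (λ l → proj₁ (full l) , λ n c≤n → _ , c≤n , proj₂ (full l)) (π₂ (τ j))
... | N , chain = N ⊔ (i ⊔ j) , λ { n bound (τ′ , n′ , eq , inZ) →
  refute n bound τ′ (↾-injective (Str τ) (Str τ′) n n′ eq) inZ }
  where
  refute : ∀ n → N ⊔ (i ⊔ j) ≤ n → ∀ τ′ →
    (∀ k a b → a ≤ n → b ≤ n → link k (τ a) (τ b) ≡ link k (τ′ a) (τ′ b)) →
    ¬ (∀ j → π₁ (τ′ j) ≡ π₁ (τ′ i) → Z (π₂ (τ′ j)))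
  refute n bound τ′ agree inZ = ¬Zj (subst Z
    (labels-agree τ τ′ n agree (π₂ (τ j)) (chain n (≤-trans (m≤m⊔n N _) bound)) j≤n refl)
    (inZ j (classes-agree τ τ′ n agree j≤n i≤n same-class)))
    where
    i≤n : i ≤ n
    i≤n = ≤-trans (m≤m⊔n i j) (≤-trans (m≤n⊔m N _) bound)
    j≤n : j ≤ n
    j≤n = ≤-trans (m≤n⊔m i j) (≤-trans (m≤n⊔m N _) bound)

-- Labels that tell the additional classes apart

𝒜-full : ∀ k → 𝒜 1ᶜ k
𝒜-full k = 0 at A-kind 0 0 k 0

ℬ-full : ∀ k → ℬ 1ᶜ k
ℬ-full k = 0 at B-kind 0 0 k 0

𝒜-special-0 : ¬ 𝒜 0 0
𝒜-special-0 (t at h) = 0≢1+n (trans (sym (A-special 0 t)) h)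

𝒜-special-suc : ∀ {n} → 𝒜 0 (suc n) ⇔ Halts n
𝒜-special-suc {n} = mk⇔ (λ (t at h) → t , trans (sym (A-special (suc n) t)) h)
                        (λ (t , h) → t at trans (A-special (suc n) t) h)

ℬ-special-0 : ℬ 0 0
ℬ-special-0 = 0 at B-special 0 0

ℬ-special-suc : ∀ {k} → ¬ ℬ 0 (suc k)
ℬ-special-suc {k} (t at h) = 0≢1+n (trans (sym (B-special (suc k) t)) h)

kindAt-own : ∀ n t → kindAt (suc n) (suc n) t ≡ 1
kindAt-own n t = cong (λ v → ifz v (haltingAt (suc n) t) 1) (≡ᵇ-refl n)

-- Every positive label escapes, since the additional class of B has only the label 0.
𝒜⊈ℬ-special : ∀ c k → 𝒜 c k → ∃[ k′ ] (𝒜 c k′ × ¬ ℬ 0 k′)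
𝒜⊈ℬ-special = class-cases (λ c → ∀ k → 𝒜 c k → ∃[ k′ ] (𝒜 c k′ × ¬ ℬ 0 k′))
  (λ { zero p → contradiction p 𝒜-special-0 ; (suc k) p → suc k , p , ℬ-special-suc })
  (λ { zero j k _ → 1 , (0 at A-kind 0 j 1 0) , ℬ-special-suc
     ; (suc n) j k _ →
         suc n , (0 at trans (A-kind (suc n) j (suc n) 0) (kindAt-own n 0)) , ℬ-special-suc })

module _ (em : ExcludedMiddle 0ℓ) where

  -- The additional class of A lacks 0, and it lacks `suc n` if `n` does not halt. For kind `suc n`
  -- the first escapes if `n` halts and the second otherwise.
  ℬ⊈𝒜-special : ∀ c k → ℬ c k → ∃[ k′ ] (ℬ c k′ × ¬ 𝒜 0 k′)
  ℬ⊈𝒜-special = class-cases (λ c → ∀ k → ℬ c k → ∃[ k′ ] (ℬ c k′ × ¬ 𝒜 0 k′))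
    (λ k _ → 0 , ℬ-special-0 , 𝒜-special-0)
    (λ { zero j k _ → 0 , (0 at B-kind 0 j 0 0) , 𝒜-special-0
       ; (suc n) j k _ → kind n j (em {Halts n}) })
    where
    kind : ∀ n j → _ → ∃[ k′ ] (ℬ (suc ⟨ suc n , j ⟩) k′ × ¬ 𝒜 0 k′)
    kind n j (yes (t , h)) = 0 , (t at trans (B-kind (suc n) j 0 t) h) , 𝒜-special-0
    kind n j (no ¬halts) =
      suc n , (0 at trans (B-kind (suc n) j (suc n) 0) (kindAt-own n 0)) ,
      ¬halts ∘ Equivalence.to 𝒜-special-suc

  module Observing (W : ℕ → ℕ → Set) (τ₀ : ℕ → ℕ) (P : Presents W τ₀) (full : ∀ k → W 1ᶜ k)
    (Z : ℕ → Set) (k₀ : ℕ) (special : W 0 k₀)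
    (escape : ∀ c k → W c k → ∃[ k′ ] (W c k′ × ¬ Z k′))
    (S : Structure 𝕃) (iso : S ≅ Str τ₀) where

    private
      open Inverse (proj₁ iso) using (to; from; strictlyInverseˡ)

      τ : ℕ → ℕ
      τ = τ₀ ∘ to

      occurs : ∀ {c k} → W c k → ∃[ a ] τ a ≡ ⟨ c , k ⟩
      occurs {c} {k} p with recurrent P c k p 0
      ... | a , _ , eq = from a , trans (cong τ₀ (strictlyInverseˡ a)) eq

      S≡Str : ∀ n → S ↾ n ≡ Str τ ↾ n
      S≡Str n = ↾-cong n (λ i a b _ _ → proj₂ iso i (a ∷ b ∷ []))

      full-label : ∀ k → ∃[ a ] π₂ (τ a) ≡ k
      full-label k with occurs (full k)
      ... | a , eq = a , trans (cong π₂ eq) (π₂-⟨⟩ 1ᶜ k)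

    eventually-¬looks : ∀ m → Eventually (λ n → ∀ i → i ≤ m → ¬ Looks Z (S ↾ n) i)
    eventually-¬looks = eventually-≤ λ i → refuted i
      where
      refuted : ∀ i → Eventually (λ n → ¬ Looks Z (S ↾ n) i)
      refuted i with escape _ _ (valid P (to i))
      ... | k′ , p , ¬Zk′ with occurs p
      ... | j , eq with refutable {Z} τ full-label i j (trans (cong π₁ eq) (π₁-⟨⟩ _ k′))
                          (¬Zk′ ∘ subst Z (trans (cong π₂ eq) (π₂-⟨⟩ _ k′)))
      ... | N , ¬looks = N , λ n N≤n → ¬looks n N≤n ∘ subst (λ F → Looks Z F i) (S≡Str n)

    always-looks : ∃[ x ] ∀ n → Looks (W 0) (S ↾ n) x
    always-looks with occurs special
    ... | x , eq = x , λ n → τ , n , S≡Str n , λ j same → subst (λ c → W c (π₂ (τ j)))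
      (trans same (trans (cong π₁ eq) (π₁-⟨⟩ 0 k₀))) (valid P (to j))

  -- An element of the additional class looks right forever, while each wrong candidate is refuted
  -- in time. Comparing only with candidates up to `i` leaves finitely many refutations to wait for.
  A-evidence : FiniteDiagram 𝕃 → Set
  A-evidence F = ∃[ i ] (Looks (𝒜 0) F i × ∀ j → j ≤ i → ¬ Looks (ℬ 0) F j)

  learn : FiniteDiagram 𝕃 → Hypothesis 2
  learn F with em {A-evidence F}
  ... | yes _ = just (# 0)
  ... | no _  = just (# 1)

  learn-A : ∀ F → A-evidence F → learn F ≡ just (# 0)
  learn-A F e with em {A-evidence F}
  ... | yes _ = refl
  ... | no ¬e = contradiction e ¬e

  learn-B : ∀ F → ¬ A-evidence F → learn F ≡ just (# 1)
  learn-B F ¬e with em {A-evidence F}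
  ... | yes e = contradiction e ¬e
  ... | no _  = refl

  A B : Structure 𝕃
  A = Str A-types
  B = Str B-types

  -- The additional class of A needs an element that the learner can find.
  A-special-nonempty : 𝒜 0 (suc (encode {1} zeroᴿ))
  A-special-nonempty = Equivalence.from 𝒜-special-suc (Halts-intro {zeroᴿ} ⇓zero)

  module _ (F : ℕ → FiniteDiagram 𝕃) (x : ℕ) where

    settles-A : (∀ n → Looks (𝒜 0) (F n) x) →
                Eventually (λ n → ∀ i → i ≤ x → ¬ Looks (ℬ 0) (F n) i) →
                Eventually (λ n → learn (F n) ≡ just (# 0))
    settles-A looks (N , ¬looks) = N , λ n N≤n → learn-A (F n) (x , looks n , ¬looks n N≤n)

    settles-B : (∀ n → Looks (ℬ 0) (F n) x) →
                Eventually (λ n → ∀ i → i ≤ x → ¬ Looks (𝒜 0) (F n) i) →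
                Eventually (λ n → learn (F n) ≡ just (# 1))
    settles-B looks (N , ¬looks) = N , λ n N≤n → learn-B (F n) (no-evidence n N≤n)
      where
      no-evidence : ∀ n → N ≤ n → ¬ A-evidence (F n)
      -- Candidates up to `x` are refuted by now, and `x` itself rules out those from `x` on.
      no-evidence n N≤n (i , looks-A , ¬looks-B) with ≤-total i x
      ... | inj₁ i≤x = ¬looks n N≤n i i≤x looks-A
      ... | inj₂ x≤i = ¬looks-B x x≤i (looks n)

  learns-A : ∀ S → S ≅ A → Eventually (λ n → learn (S ↾ n) ≡ just (# 0))
  learns-A S iso = settles-A (S ↾_) (proj₁ always-looks) (proj₂ always-looks)
    (eventually-¬looks (proj₁ always-looks))
    where open Observing 𝒜 A-types A-presents 𝒜-full (ℬ 0) _ A-special-nonempty 𝒜⊈ℬ-special S iso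

  learns-B : ∀ S → S ≅ B → Eventually (λ n → learn (S ↾ n) ≡ just (# 1))
  learns-B S iso = settles-B (S ↾_) (proj₁ always-looks) (proj₂ always-looks)
    (eventually-¬looks (proj₁ always-looks))
    where open Observing ℬ B-types B-presents ℬ-full (𝒜 0) 0 ℬ-special-0 ℬ⊈𝒜-special S iso

  members : Fin 2 → Structure 𝕃
  members zero       = A
  members (suc zero) = B

  learns-member : ∀ a S → S ≅ members a → Eventually (λ n → learn (S ↾ n) ≡ just a)
  learns-member zero       = learns-A
  learns-member (suc zero) = learns-B

  limits-agree : ∀ {f : ℕ → Hypothesis 2} {a b} →
    Eventually (λ n → f n ≡ just a) → Eventually (λ n → f n ≡ just b) → a ≡ b
  limits-agree (N , p) (N′ , q) =
    just-injective (trans (sym (p (N ⊔ N′) (m≤m⊔n N N′))) (q (N ⊔ N′) (m≤n⊔m N N′)))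

  ≅-refl : ∀ {S : Structure 𝕃} → S ≅ S
  ≅-refl = ↔-id ℕ , λ { i (a ∷ b ∷ []) → refl }

  𝔎 : Family 𝕃 2
  𝔎 = record
    { member = members
    ; computable = λ { zero → structure-computable (typesᶠ Aᶠ) 0
                     ; (suc zero) → structure-computable (typesᶠ Bᶠ) 0 }
    -- On a common copy the learner would converge to both hypotheses.
    ; non-isomorphic = λ a b a≢b iso →
        a≢b (limits-agree (learns-member a (members a) ≅-refl) (learns-member b (members a) iso)) }

  𝔎-learnable : Learnable 𝔎
  𝔎-learnable = (λ o → learn (value o)) , λ { S (b , iso) a → mk⇔
    (λ limit → subst (λ a → S ≅ members a) (limits-agree (learns-member b S iso) limit) iso)
    (learns-member a S) }

-- Defeating computable learners

least : ∀ (f : ℕ → ℕ) k → f k ≡ 0 → ∃[ m ] (f m ≡ 0 × ∀ j → j < m → ∃[ y ] f j ≡ suc y)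
least f zero    fk≡0 = 0 , fk≡0 , λ j ()
least f (suc k) fk≡0 with f 0 in f0 | least (f ∘ suc) k fk≡0
... | zero  | _ = 0 , f0 , λ j ()
... | suc y | m , fm≡0 , below =
  suc m , fm≡0 , λ { zero _ → y , f0 ; (suc j) j<m → below j (s≤s⁻¹ j<m) }

module _ {n} (f : Fn (suc n)) (zeros : ∀ xs → ∃[ k ] ⟦ f ⟧ (k ∷ xs) ≡ 0) where

  leastZero : ∀ xs → ∃[ k ] (⟦ f ⟧ (k ∷ xs) ≡ 0 × ∀ j → j < k → ∃[ y ] ⟦ f ⟧ (j ∷ xs) ≡ suc y)
  leastZero xs = least (λ k → ⟦ f ⟧ (k ∷ xs)) (proj₁ (zeros xs)) (proj₂ (zeros xs))

  minimiseᶠ : Fn n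
  minimiseᶠ = record
    { ⟦_⟧ = λ xs → proj₁ (leastZero xs)
    ; program = μ (program f)
    ; computes = λ xs → ⇓μ
        (subst (program f [ proj₁ (leastZero xs) ∷ xs ]⇓_)
          (proj₁ (proj₂ (leastZero xs))) (computes f _))
        (λ j j<k → let (y , eq) = proj₂ (proj₂ (leastZero xs)) j j<k in
          y , subst (program f [ j ∷ xs ]⇓_) eq (computes f (j ∷ xs))) }

  minimise-zero : ∀ xs → ⟦ f ⟧ (⟦ minimiseᶠ ⟧ xs ∷ xs) ≡ 0
  minimise-zero xs = proj₁ (proj₂ (leastZero xs))

-- χ(n) = 0 only if g takes the value v before n is seen to halt; running χ on its own code
-- forces this to happen for some n that does halt.

module _ (g : Fn 2) (v : ℕ) where

  private
    undecidedᶠ : Fn 2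
    undecidedᶠ =
      ifzᶠ (haltsᶠ (var (# 1)) (var (# 0))) (ifzᶠ (g ≡ᶠ lit v) (lit 1) (lit 0)) (lit 0)

    undecided : ℕ → ℕ → ℕ
    undecided h w = ifz h (ifz (bit (w ≡ᵇ v)) 1 0) 0

    undecided-value : ∀ w → undecided 0 w ≡ 0 → w ≡ v
    undecided-value w eq with w ≟ v
    ... | yes w≡v = w≡v
    ... | no w≢v  =
      contradiction (trans (sym eq) (cong (λ u → ifz u 1 0) (≢⇒≡ᵇ w≢v))) 0≢1+n

  some-halting-value : ExcludedMiddle 0ℓ →
                       (∀ n → ¬ Halts n → ∃[ s ] ⟦ g ⟧ (s ∷ n ∷ []) ≡ v) →
                       ∃₂ λ n s → Halts n × ⟦ g ⟧ (s ∷ n ∷ []) ≡ v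
  some-halting-value em value = e , s , e-halts ,
    undecided-value _ (trans (cong (λ h → undecided h (⟦ g ⟧ (s ∷ e ∷ []))) (sym χ-at-e))
      (minimise-zero undecidedᶠ zeros (e ∷ [])))
    where
    -- The search always ends: either `n` is seen to halt, or it never halts and `g` takes the value
    -- `v`.
    zeros : ∀ xs → ∃[ s ] ⟦ undecidedᶠ ⟧ (s ∷ xs) ≡ 0
    zeros (n ∷ []) = by-halting (em {Halts n})
      where
      decides : ∀ h {w} → w ≡ v → undecided h w ≡ 0
      decides zero    refl = cong (λ u → ifz u 1 0) (≡ᵇ-refl v)
      decides (suc h) eq   = refl
      by-halting : Dec (Halts n) → ∃[ s ] undecided (halts n s) (⟦ g ⟧ (s ∷ n ∷ [])) ≡ 0
      by-halting (yes (t , h)) = t , cong (λ h → undecided h (⟦ g ⟧ (t ∷ n ∷ []))) h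
      by-halting (no ¬halts)   = let (s , eq) = value n ¬halts in s , decides (halts n s) eq

    stageᶠ χᶠ : Fn 1
    stageᶠ = minimiseᶠ undecidedᶠ zeros
    χᶠ = haltsᶠ (var (# 0)) stageᶠ

    e s : ℕ
    e = encode (program χᶠ)
    s = ⟦ stageᶠ ⟧ (e ∷ [])

    -- The value of `χᶠ` at its own code `e` is `halts e s`. If this were 1, program `e` would stop
    -- on `e` with value 0, so the value would be 0 after all.
    χ-at-e : halts e s ≡ 0
    χ-at-e = not-1 (run s (start e) ≡ᵇ 0) refl
      where
      not-1 : ∀ b → (run s (start e) ≡ᵇ 0) ≡ b → halts e s ≡ 0
      not-1 false eq = cong bit eq
      not-1 true  eq = Halts-elim {program χᶠ} (computes χᶠ (e ∷ [])) (s , cong bit eq)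

    e-halts : Halts e
    e-halts = Halts-intro {program χᶠ}
      (subst (program χᶠ [ e ∷ [] ]⇓_) χ-at-e (computes χᶠ (e ∷ [])))

bounded-below : ∀ (f : ℕ → ℕ) l → ∃[ b ] (∀ {i} → i < l → f i < b)
bounded-below f zero = 0 , λ ()
bounded-below f (suc l) with bounded-below f l
... | b , f<b = suc (b + f l) , λ i<1+l → below (m≤n⇒m<n∨m≡n (s≤s⁻¹ i<1+l))
  where
  below : ∀ {i} → i < l ⊎ i ≡ l → f i < suc (b + f l)
  below (inj₁ i<l)  = m≤n⇒m≤1+n (≤-trans (f<b i<l) (m≤m+n b (f l)))
  below (inj₂ refl) = s≤s (m≤n+m (f l) b)

codeHypothesis-injective : ∀ {m} {g h : Hypothesis m} → codeHypothesis g ≡ codeHypothesis h → g ≡ h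
codeHypothesis-injective {g = nothing} {nothing} eq = refl
codeHypothesis-injective {g = just a}  {just b}  eq = cong just (toℕ-injective (suc-injective eq))

TypesOfA : (ℕ → ℕ) → Set
TypesOfA τ = ∀ i → 𝒜 (π₁ (τ i)) (π₂ (τ i))

module _ (em : ExcludedMiddle 0ℓ) (M : Learner (𝔎 em)) (φ : Rec 1)
  (φ-computes : ∀ o → φ [ codeDiagram (value o) ∷ [] ]⇓ codeHypothesis (M o))
  (M-learns : Learns (𝔎 em) M) where

  SaysB : (ℕ → ℕ) → ℕ → Set
  SaysB τ n = ∃[ S∈LD ] M (observe (𝔎 em) (Str τ) S∈LD n) ≡ just (# 1)

  Forces : (ℕ → ℕ) → ℕ → Set
  Forces τ l = ∃₂ λ τ′ n → TypesOfA τ′ × (∀ {i} → i < l → τ′ i ≡ τ i) × l ≤ n × SaysB τ′ n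

  module Forcing (τ : ℕ → ℕ) (τ-valid : TypesOfA τ) (l : ℕ) where

    open Dichotomy (proj₁ (bounded-below (π₁ ∘ τ) l)) τ l τ-valid (proj₂ (bounded-below (π₁ ∘ τ) l))

    C∈LD : ∀ n → LD (𝔎 em) (Str (C-types n))
    C∈LD n with em {Halts n}
    ... | yes halts = # 0 , C≅A em n halts
    ... | no ¬halts = # 1 , C≅B em n ¬halts

    guess : ℕ → ℕ → Hypothesis 2
    -- Adding `l` makes every observation cover the prescribed part.
    guess n s = M (observe (𝔎 em) (Str (C-types n)) (C∈LD n) (s + l))

    diagramAtᶠ : Fn 2
    diagramAtᶠ = diagramᶠ C-typesᶠ ⊙ (var (# 0) +ᶠ lit l ∷ var (# 1) ∷ [])

    -- Membership in the learning domain comes from excluded middle, but `φ` reads only the diagram,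
    -- whose code is computable uniformly in `n`.
    guessᶠ : Fn 2
    guessᶠ = record
      { ⟦_⟧ = λ { (s ∷ n ∷ []) → codeHypothesis (guess n s) }
      ; program = comp φ (program diagramAtᶠ ∷ [])
      ; computes = λ { (s ∷ n ∷ []) →
          ⇓comp (computes diagramAtᶠ (s ∷ n ∷ []) ∷ []) (φ-computes _) } }

    -- The code of the hypothesis B is 2.
    guesses-B : ∀ n → ¬ Halts n → ∃[ s ] codeHypothesis (guess n s) ≡ 2
    guesses-B n ¬halts =
      let (N , limit) =
            Equivalence.from (M-learns (Str (C-types n)) (C∈LD n) (# 1)) (C≅B em n ¬halts)
      in N , cong codeHypothesis (limit (N + l) (m≤m+n N l))

    fooled : ∃₂ λ n s → Halts n × codeHypothesis (guess n s) ≡ 2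
    fooled = some-halting-value guessᶠ 2 em guesses-B

    force-B : Forces τ l
    force-B = let (e , s , halts , eq) = fooled in
      C-types e , s + l ,
      (λ i → Equivalence.to (𝒞⇔𝒜 e halts _ _) (valid (C-presents e) i)) ,
      prefix-< τ l (typesᶠ (Cᶠ fresh)) e , m≤n+m l s , C∈LD e , codeHypothesis-injective eq

  opaque

    force-B : ∀ τ → TypesOfA τ → ∀ l → Forces τ l
    force-B = Forcing.force-B

  -- A copy of A on which the learner says B infinitely often

  overwrite : (ℕ → ℕ) → ℕ → ℕ → ℕ → ℕ
  overwrite τ l t i = ifz (bit (i ≡ᵇ l)) (τ i) t

  overwrite-at : ∀ τ l t → overwrite τ l t l ≡ t
  overwrite-at τ l t = cong (λ v → ifz v (τ l) t) (≡ᵇ-refl l)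

  overwrite-< : ∀ τ l t {i} → i < l → overwrite τ l t i ≡ τ i
  overwrite-< τ l t {i} i<l = cong (λ v → ifz v (τ i) t) (≢⇒≡ᵇ (<⇒≢ i<l))

  overwrite-valid : ∀ τ l {t} → TypesOfA τ → 𝒜 (π₁ t) (π₂ t) → TypesOfA (overwrite τ l t)
  overwrite-valid τ l {t} τ-valid t-valid i = choose (bit (i ≡ᵇ l))
    where
    choose : ∀ v → 𝒜 (π₁ (ifz v (τ i) t)) (π₂ (ifz v (τ i) t))
    choose zero    = τ-valid i
    choose (suc v) = t-valid

  record Stage : Set where
    field
      τ       : ℕ → ℕ
      τ-valid : TypesOfA τ
      size    : ℕ

  open Stage

  record _⊏[_]_ (σ : Stage) (t : ℕ) (σ′ : Stage) : Set where
    field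
      extends : ∀ {i} → i < size σ → τ σ′ i ≡ τ σ i
      added   : τ σ′ (size σ) ≡ t
      fooled  : ∃[ n ] (size σ < n × size σ′ ≡ suc n × SaysB (τ σ′) n)

  open _⊏[_]_

  -- The next element gets the `j`-th type of A, so that no type is missed in the limit; then the
  -- learner is forced to say B without changing that element.
  successor : ∀ σ j → Σ[ σ′ ∈ Stage ] σ ⊏[ A-types j ] σ′
  successor σ j = from-forced (force-B (overwrite (τ σ) l (A-types j))
    (overwrite-valid (τ σ) l (τ-valid σ) (valid A-presents j)) (suc l))
    where
    l = size σ
    from-forced : Forces (overwrite (τ σ) l (A-types j)) (suc l) →
                  Σ[ σ′ ∈ Stage ] σ ⊏[ A-types j ] σ′
    from-forced (τ′ , n , τ′-valid , agree , l<n , says-B) =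
      -- The restriction to `n` includes `n`, so `suc n` values must be kept for the learner to see
      -- the same data later.
      record { τ = τ′ ; τ-valid = τ′-valid ; size = suc n } ,
      record
        { extends = λ i<l → trans (agree (m≤n⇒m≤1+n i<l)) (overwrite-< (τ σ) l _ i<l)
        ; added = trans (agree ≤-refl) (overwrite-at (τ σ) l _)
        ; fooled = n , l<n , refl , says-B }

  stage : ℕ → Stage
  stage zero    = record { τ = A-types ; τ-valid = valid A-presents ; size = 0 }
  stage (suc j) = proj₁ (successor (stage j) j)

  step-of : ∀ j → stage j ⊏[ A-types j ] stage (suc j)
  step-of j = proj₂ (successor (stage j) j)

  size-increases : ∀ j → size (stage j) < size (stage (suc j))
  size-increases j with fooled (step-of j)
  ... | n , l<n , eq , _ = subst (size (stage j) <_) (sym eq) (m≤n⇒m≤1+n l<n)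

  j≤size : ∀ j → j ≤ size (stage j)
  j≤size zero    = z≤n
  j≤size (suc j) = ≤-<-trans (j≤size j) (size-increases j)

  size-mono : ∀ k j → size (stage j) ≤ size (stage (k + j))
  size-mono zero    j = ≤-refl
  size-mono (suc k) j = ≤-trans (size-mono k j) (<⇒≤ (size-increases (k + j)))

  stage-agree : ∀ k j {i} → i < size (stage j) → τ (stage (k + j)) i ≡ τ (stage j) i
  stage-agree zero    j i<l = refl
  stage-agree (suc k) j i<l =
    trans (extends (step-of (k + j)) (<-≤-trans i<l (size-mono k j))) (stage-agree k j i<l)

  limit-types : ℕ → ℕ
  limit-types i = τ (stage (suc i)) i

  limit-agree : ∀ j {i} → i < size (stage j) → limit-types i ≡ τ (stage j) i
  limit-agree j {i} i<l = trans (sym (stage-agree j (suc i) (j≤size (suc i))))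
    (trans (cong (λ k → τ (stage k) i) (+-comm j (suc i))) (stage-agree (suc i) j i<l))

  -- The added elements copy the list `A-types` one by one, so each type recurs as it does there.
  limit-presents : Presents 𝒜 limit-types
  limit-presents = record { valid = λ i → τ-valid (stage (suc i)) i ; recurrent = recurs }
    where
    recurs : ∀ c k → 𝒜 c k → Infinitely (λ a → limit-types a ≡ ⟨ c , k ⟩)
    recurs c k p m with recurrent A-presents c k p m
    ... | j , m≤j , eq = size (stage j) , ≤-trans m≤j (j≤size j) ,
      trans (limit-agree (suc j) (size-increases j)) (trans (added (step-of j)) eq)

  limit≅A : Str limit-types ≅ Str A-types
  limit≅A = presents⇒≅ em limit-presents A-presents (↔-id ℕ) (λ c k → mk⇔ id id)

  limit∈LD : LD (𝔎 em) (Str limit-types)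
  limit∈LD = # 0 , limit≅A

  -- The witness in an observation is irrelevant, so the learner cannot distinguish the limit from a
  -- stage with the same restriction.
  M-cong : ∀ (o o′ : Observation (𝔎 em)) → value o ≡ value o′ → M o ≡ M o′
  M-cong (F , _) (.F , _) refl = refl

  MSays : Fin 2 → ℕ → Set
  MSays a n = M (observe (𝔎 em) (Str limit-types) limit∈LD n) ≡ just a

  says-B-at-limit : ∀ N → ∃[ n ] (N ≤ n × MSays (# 1) n)
  says-B-at-limit N = from-fooled (fooled (step-of N))
    where
    from-fooled : ∃[ n ] (size (stage N) < n × size (stage (suc N)) ≡ suc n ×
                          SaysB (τ (stage (suc N))) n) →
                  ∃[ n ] (N ≤ n × MSays (# 1) n)
    from-fooled (n , l<n , eq , S∈LD , says-B) = n , ≤-trans (j≤size N) (<⇒≤ l<n) , trans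
      (M-cong (observe (𝔎 em) (Str limit-types) limit∈LD n)
        (observe (𝔎 em) (Str (τ (stage (suc N)))) S∈LD n)
        (↾-cong n (λ i a b a≤n b≤n → cong₂ (link i) (below a≤n) (below b≤n))))
      says-B
      where
      below : ∀ {a} → a ≤ n → limit-types a ≡ τ (stage (suc N)) a
      below {a} a≤n = limit-agree (suc N) (subst (a <_) (sym eq) (s≤s a≤n))

  not-computably-learned : ⊥
  not-computably-learned =
    let (N , says-A) = Equivalence.from (M-learns (Str limit-types) limit∈LD (# 0)) limit≅A
        (n , N≤n , says-B) = says-B-at-limit N
    in contradiction (just-injective (trans (sym (says-A n N≤n)) says-B)) λ ()

theorem4p1 : ExcludedMiddle 0ℓ →
    Σ[ L ∈ Signature ] Σ[ K ∈ Family L 2 ]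
    (Learnable K × ¬ ComputablyLearnable K)
theorem4p1 em = 𝕃 , 𝔎 em , 𝔎-learnable em ,
  λ { (M , (φ , φ-computes) , M-learns) → not-computably-learned em M φ φ-computes M-learns }
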